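{- There is an absolute constant $c>0$ such that for every $n\ge 2$ and every graph $H$ on $n$ vertices with at least one edge, $Q(f_{[H]}) \ge c\, n$.
   Context: A homomorphism from a graph $H$ to a graph $G$ is a map $h:V(H)\to V(G)$ (not necessarily injective) such that $\{h(u),h(v)\}\in E(G)$ whenever $\{u,v\}\in E(H)$ (graphs are simple, so in particular $h(u)\ne h(v)$ for adjacent $u,v$). For a fixed graph $H$ on $n$ vertices, $f_{[H]}:\{0,1\}^{\binom n2}\to\{0,1\}$ takes as input a graph $G$ on vertex set $[n]$ given by its edge-indicator bits, and $f_{[H]}(G)=1$ iff $H$ admits a homomorphism into $G$. $Q(f)$ denotes the bounded-error (success probability at least $2/3$) quantum query complexity of a Boolean function $f$. -}

module Defs where

open import Data.Bool.Base using (Bool; true; false; if_then_else_; _xor_; T)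
import Data.Bool.Properties as Bool
open import Data.Bool.Properties using (T?)
open import Data.Fin.Base using (Fin; zero; suc; _↑ˡ_; _↑ʳ_)
import Data.Fin.Properties as Fin
import Data.Integer.Base as ℤ
open import Data.Nat.Base as ℕ using (ℕ; zero; suc; _⊔_)
open import Data.Nat.Combinatorics using (_C_; nC1≡n; nCk+nC[k+1]≡[n+1]C[k+1])
import Data.Nat.Properties as ℕ
open import Data.Product.Base using (Σ; ∃; _×_; _,_)
open import Data.Product.Properties using (≡-dec)
open import Data.Rational.Base using (ℚ; 0ℚ; 1ℚ; ½; _+_; _*_; -_; _-_; ∣_∣; _≤_; _<_; _/_; 1/_; NonZero; Positive; positive; nonNegative)
import Data.Rational.Properties as ℚ
open import Data.Rational.Solver using (module +-*-Solver)
open import Data.Vec.Base as Vec using (Vec; []; _∷_; lookup; tabulate)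
open import Data.Vec.Functional using (foldr)
open import Data.Vec.Properties using (lookup∘tabulate)
open import Function.Base using (_∘_)
open import Relation.Binary.Definitions using (DecidableEquality)
open import Relation.Binary.PropositionalEquality using (_≡_; refl; sym; trans; cong; cong₂; subst₂)
open import Relation.Nullary.Decidable using (Dec; does; map′; _→-dec_)
open import Relation.Unary using (Decidable)

-- Real numbers: Cauchy sequences of rationals, with equality and order up
-- to arbitrarily small rational error.

Cauchy : (ℕ → ℚ) → Set
Cauchy x = ∀ ε → 0ℚ < ε →
  ∃ λ N → ∀ m n → N ℕ.≤ m → N ℕ.≤ n → ∣ x m - x n ∣ ≤ ε

record ℝ : Set where
  constructor mkℝ
  field
    seq    : ℕ → ℚ
    cauchy : Cauchy seq

open ℝ public

infix 4 _≈ℝ_ _≤ℝ_ _<ℝ_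

_≈ℝ_ : ℝ → ℝ → Set
x ≈ℝ y = ∀ ε → 0ℚ < ε →
  ∃ λ N → ∀ n → N ℕ.≤ n → ∣ seq x n - seq y n ∣ ≤ ε

_≤ℝ_ : ℝ → ℝ → Set
x ≤ℝ y = ∀ ε → 0ℚ < ε →
  ∃ λ N → ∀ n → N ℕ.≤ n → seq x n ≤ seq y n + ε

_<ℝ_ : ℝ → ℝ → Set
x <ℝ y = ∃ λ ε → 0ℚ < ε ×
  (∃ λ N → ∀ n → N ℕ.≤ n → seq x n + ε ≤ seq y n)

private
  module Identities where
    open +-*-Solver

    neg-sub : ∀ a b → - a - - b ≡ - (a - b)
    neg-sub = solve 2 (λ a b → :- a :- :- b := :- (a :- b)) refl

    add-sub : ∀ a b c d → (a + b) - (c + d) ≡ (a - c) + (b - d)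
    add-sub = solve 4 (λ a b c d → (a :+ b) :- (c :+ d) := (a :- c) :+ (b :- d)) refl

    sub-add : ∀ a b → a ≡ (a - b) + b
    sub-add = solve 2 (λ a b → a := (a :- b) :+ b) refl

    mul-sub : ∀ a b c d → a * b - c * d ≡ a * (b - d) + d * (a - c)
    mul-sub = solve 4 (λ a b c d →
      a :* b :- c :* d := a :* (b :- d) :+ d :* (a :- c)) refl

  open Identities

abstract
  const-cauchy : ∀ q → Cauchy (λ _ → q)
  const-cauchy q ε ε>0 = 0 , λ _ _ _ _ →
    ℚ.≤-trans (ℚ.≤-reflexive (cong ∣_∣ (ℚ.+-inverseʳ q))) (ℚ.<⇒≤ ε>0)

  neg-cauchy : ∀ {x} → Cauchy x → Cauchy (λ n → - x n)
  neg-cauchy {x} cx ε ε>0 with cx ε ε>0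
  ... | N , h = N , λ m n N≤m N≤n →
    ℚ.≤-trans (ℚ.≤-reflexive (eq (x m) (x n))) (h m n N≤m N≤n)
    where
    eq : ∀ a b → ∣ - a - - b ∣ ≡ ∣ a - b ∣
    eq a b = trans
      (cong ∣_∣ (neg-sub a b))
      (ℚ.∣-p∣≡∣p∣ (a - b))

  add-cauchy : ∀ {x y} → Cauchy x → Cauchy y → Cauchy (λ n → x n + y n)
  add-cauchy {x} {y} cx cy ε ε>0
    with cx (½ * ε) ε/2>0 | cy (½ * ε) ε/2>0
    where
    ε/2>0 : 0ℚ < ½ * ε
    ε/2>0 = ℚ.positive⁻¹ (½ * ε) {{ℚ.pos*pos⇒pos ½ ε {{positive ε>0}}}}
  ... | M , hx | N , hy = M ⊔ N , λ m n p q → begin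
    ∣ (x m + y m) - (x n + y n) ∣
      ≡⟨ cong ∣_∣ (add-sub (x m) (y m) (x n) (y n)) ⟩
    ∣ (x m - x n) + (y m - y n) ∣
      ≤⟨ ℚ.∣p+q∣≤∣p∣+∣q∣ (x m - x n) (y m - y n) ⟩
    ∣ x m - x n ∣ + ∣ y m - y n ∣
      ≤⟨ ℚ.+-mono-≤ (hx m n (ℕ.m⊔n≤o⇒m≤o M N p) (ℕ.m⊔n≤o⇒m≤o M N q))
                    (hy m n (ℕ.m⊔n≤o⇒n≤o M N p) (ℕ.m⊔n≤o⇒n≤o M N q)) ⟩
    ½ * ε + ½ * ε
      ≡⟨ sym (ℚ.*-distribʳ-+ ε ½ ½) ⟩
    1ℚ * ε
      ≡⟨ ℚ.*-identityˡ ε ⟩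
    ε ∎
    where open ℚ.≤-Reasoning

  cauchy-bound : ∀ {x} → Cauchy x →
    ∃ λ B → 0ℚ < B × (∃ λ N → ∀ n → N ℕ.≤ n → ∣ x n ∣ ≤ B)
  cauchy-bound {x} cx with cx 1ℚ (ℚ.positive⁻¹ 1ℚ)
  ... | N , h = 1ℚ + ∣ x N ∣
              , ℚ.+-mono-<-≤ (ℚ.positive⁻¹ 1ℚ) (ℚ.0≤∣p∣ (x N))
              , N , λ n N≤n → begin
    ∣ x n ∣
      ≡⟨ cong ∣_∣ (sub-add (x n) (x N)) ⟩
    ∣ (x n - x N) + x N ∣
      ≤⟨ ℚ.∣p+q∣≤∣p∣+∣q∣ (x n - x N) (x N) ⟩
    ∣ x n - x N ∣ + ∣ x N ∣
      ≤⟨ ℚ.+-monoˡ-≤ ∣ x N ∣ (h n N N≤n ℕ.≤-refl) ⟩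
    1ℚ + ∣ x N ∣ ∎
    where open ℚ.≤-Reasoning

  divide : ∀ S ε → 0ℚ < S → 0ℚ < ε → ∃ λ δ → 0ℚ < δ × S * δ ≡ ε
  divide S ε S>0 ε>0 = S⁻¹ * ε , δ>0 , Sδ≡ε
    where
    S-pos : Positive S
    S-pos = positive S>0
    S-nonZero : NonZero S
    S-nonZero = ℚ.pos⇒nonZero S {{S-pos}}
    S⁻¹ : ℚ
    S⁻¹ = (1/ S) {{S-nonZero}}
    δ>0 : 0ℚ < S⁻¹ * ε
    δ>0 = ℚ.positive⁻¹ (S⁻¹ * ε)
      {{ℚ.pos*pos⇒pos S⁻¹ {{ℚ.1/pos⇒pos S {{S-pos}}}} ε {{positive ε>0}}}}
    Sδ≡ε : S * (S⁻¹ * ε) ≡ ε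
    Sδ≡ε = trans (sym (ℚ.*-assoc S S⁻¹ ε))
      (trans (cong (_* ε) (ℚ.*-inverseʳ S {{S-nonZero}})) (ℚ.*-identityˡ ε))

  ∣*∣-mono : ∀ a b {c d} → 0ℚ ≤ d → ∣ a ∣ ≤ c → ∣ b ∣ ≤ d → ∣ a * b ∣ ≤ c * d
  ∣*∣-mono a b {c} {d} d≥0 a≤c b≤d = begin
    ∣ a * b ∣      ≡⟨ ℚ.∣p*q∣≡∣p∣*∣q∣ a b ⟩
    ∣ a ∣ * ∣ b ∣  ≤⟨ ℚ.*-monoˡ-≤-nonNeg ∣ a ∣ {{nonNegative (ℚ.0≤∣p∣ a)}} b≤d ⟩
    ∣ a ∣ * d      ≤⟨ ℚ.*-monoʳ-≤-nonNeg d {{nonNegative d≥0}} a≤c ⟩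
    c * d          ∎
    where open ℚ.≤-Reasoning

  mul-step : ∀ a b c d {A B δ} → 0ℚ ≤ δ → ∣ a ∣ ≤ A → ∣ d ∣ ≤ B →
             ∣ b - d ∣ ≤ δ → ∣ a - c ∣ ≤ δ → ∣ a * b - c * d ∣ ≤ (A + B) * δ
  mul-step a b c d {A} {B} {δ} δ≥0 a≤A d≤B b~d a~c = begin
    ∣ a * b - c * d ∣
      ≡⟨ cong ∣_∣ (mul-sub a b c d) ⟩
    ∣ a * (b - d) + d * (a - c) ∣
      ≤⟨ ℚ.∣p+q∣≤∣p∣+∣q∣ (a * (b - d)) (d * (a - c)) ⟩
    ∣ a * (b - d) ∣ + ∣ d * (a - c) ∣
      ≤⟨ ℚ.+-mono-≤ (∣*∣-mono a (b - d) δ≥0 a≤A b~d) (∣*∣-mono d (a - c) δ≥0 d≤B a~c) ⟩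
    A * δ + B * δ
      ≡⟨ sym (ℚ.*-distribʳ-+ δ A B) ⟩
    (A + B) * δ ∎
    where open ℚ.≤-Reasoning

  mul-cauchy : ∀ {x y} → Cauchy x → Cauchy y → Cauchy (λ n → x n * y n)
  mul-cauchy {x} {y} cx cy ε ε>0 =
    let A , A>0 , K , boundX = cauchy-bound {x} cx
        B , B>0 , L , boundY = cauchy-bound {y} cy
        δ , δ>0 , Sδ≡ε = divide (A + B) ε (ℚ.+-mono-< A>0 B>0) ε>0
        M , hx = cx δ δ>0
        N , hy = cy δ δ>0
    in (K ⊔ L) ⊔ (M ⊔ N) , λ m n p q →
      let p₁ = ℕ.m⊔n≤o⇒m≤o (K ⊔ L) (M ⊔ N) p
          p₂ = ℕ.m⊔n≤o⇒n≤o (K ⊔ L) (M ⊔ N) p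
          q₁ = ℕ.m⊔n≤o⇒m≤o (K ⊔ L) (M ⊔ N) q
          q₂ = ℕ.m⊔n≤o⇒n≤o (K ⊔ L) (M ⊔ N) q
      in ℚ.≤-trans
           (mul-step (x m) (y m) (x n) (y n) (ℚ.<⇒≤ δ>0)
             (boundX m (ℕ.m⊔n≤o⇒m≤o K L p₁))
             (boundY n (ℕ.m⊔n≤o⇒n≤o K L q₁))
             (hy m n (ℕ.m⊔n≤o⇒n≤o M N p₂) (ℕ.m⊔n≤o⇒n≤o M N q₂))
             (hx m n (ℕ.m⊔n≤o⇒m≤o M N p₂) (ℕ.m⊔n≤o⇒m≤o M N q₂)))
           (ℚ.≤-reflexive Sδ≡ε)

fromℚ : ℚ → ℝ
fromℚ q = mkℝ (λ _ → q) (const-cauchy q)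

fromℕ : ℕ → ℝ
fromℕ n = fromℚ (ℤ.+ n / 1)

0ℝ 1ℝ : ℝ
0ℝ = fromℚ 0ℚ
1ℝ = fromℚ 1ℚ

infixl 6 _+ℝ_ _-ℝ_
infixl 7 _*ℝ_
infix  8 -ℝ_

_+ℝ_ : ℝ → ℝ → ℝ
x +ℝ y = mkℝ (λ n → seq x n + seq y n) (add-cauchy {seq x} {seq y} (cauchy x) (cauchy y))

-ℝ_ : ℝ → ℝ
-ℝ x = mkℝ (λ n → - seq x n) (neg-cauchy {seq x} (cauchy x))

_-ℝ_ : ℝ → ℝ → ℝ
x -ℝ y = x +ℝ (-ℝ y)

_*ℝ_ : ℝ → ℝ → ℝ
x *ℝ y = mkℝ (λ n → seq x n * seq y n) (mul-cauchy {seq x} {seq y} (cauchy x) (cauchy y))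

record ℂ : Set where
  constructor _+i_
  field
    re im : ℝ

open ℂ public

infix 4 _≈ℂ_

_≈ℂ_ : ℂ → ℂ → Set
z ≈ℂ w = re z ≈ℝ re w × im z ≈ℝ im w

0ℂ 1ℂ : ℂ
0ℂ = 0ℝ +i 0ℝ
1ℂ = 1ℝ +i 0ℝ

infixl 6 _+ℂ_
infixl 7 _*ℂ_

_+ℂ_ : ℂ → ℂ → ℂ
z +ℂ w = (re z +ℝ re w) +i (im z +ℝ im w)

_*ℂ_ : ℂ → ℂ → ℂ
z *ℂ w = (re z *ℝ re w -ℝ im z *ℝ im w) +i (re z *ℝ im w +ℝ im z *ℝ re w)

conj : ℂ → ℂ
conj z = re z +i (-ℝ im z)

∣_∣² : ℂ → ℝ
∣ z ∣² = re z *ℝ re z +ℝ im z *ℝ im z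

-- Basis states |i, b, w⟩: query index, answer bit, workspace of dimension W.
Basis : ℕ → ℕ → Set
Basis N W = Fin N × Bool × Fin W

_≟ᴮ_ : ∀ {N W} → DecidableEquality (Basis N W)
_≟ᴮ_ = ≡-dec Fin._≟_ (≡-dec Bool._≟_ Fin._≟_)

sumOver : ∀ {A : Set} → (A → A → A) → A → ∀ {N W} → (Basis N W → A) → A
sumOver _⊕_ e g =
  foldr _⊕_ e λ i →
    foldr _⊕_ e (λ w → g (i , false , w)) ⊕
    foldr _⊕_ e (λ w → g (i , true  , w))

∑ℝ : ∀ {N W} → (Basis N W → ℝ) → ℝ
∑ℝ = sumOver _+ℝ_ 0ℝ

∑ℂ : ∀ {N W} → (Basis N W → ℂ) → ℂ
∑ℂ = sumOver _+ℂ_ 0ℂ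

State : ℕ → ℕ → Set
State N W = Basis N W → ℂ

ket : ∀ {N W} → Basis N W → State N W
ket a b = if does (a ≟ᴮ b) then 1ℂ else 0ℂ

record Unitary (N W : ℕ) : Set where
  field
    entry : Basis N W → Basis N W → ℂ
    U†U≈I : ∀ a b → ∑ℂ (λ c → conj (entry c a) *ℂ entry c b) ≈ℂ ket a b
    UU†≈I : ∀ a b → ∑ℂ (λ c → entry a c *ℂ conj (entry b c)) ≈ℂ ket a b

open Unitary public

apply : ∀ {N W} → Unitary N W → State N W → State N W
apply U ψ a = ∑ℂ λ b → entry U a b *ℂ ψ b

Input : ℕ → Set
Input N = Fin N → Bool

-- The oracle |i, b, w⟩ ↦ |i, b ⊕ xᵢ, w⟩, which is its own inverse.
query : ∀ {N W} → Input N → State N W → State N W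
query x ψ (i , b , w) = ψ (i , b xor x i , w)

-- Circuits U_T O_x U_{T-1} ⋯ U_1 O_x U_0 applied to a basis state, followed
-- by a measurement in the computational basis whose outcome is mapped to a bit.
record Algorithm (N t : ℕ) : Set where
  field
    workspace : ℕ
    start     : Basis N workspace
    U₀        : Unitary N workspace
    Us        : Vec (Unitary N workspace) t
    output    : Basis N workspace → Bool

  finalState : Input N → State N workspace
  finalState x =
    Vec.foldl (λ _ → State N workspace) (λ ψ U → apply U (query x ψ))
      (apply U₀ (ket start)) Us

  outputProb : Input N → Bool → ℝ
  outputProb x r = ∑ℝ λ a →
    if does (output a Bool.≟ r) then ∣ finalState x a ∣² else 0ℝ

open Algorithm public

ComputesBoundedError : ∀ {N t} → Algorithm N t → (Input N → Bool) → Set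
ComputesBoundedError A f =
  ∀ x → fromℚ (ℤ.+ 2 / 3) ≤ℝ outputProb A x (f x)

-- Q(f) is the least t admitting a t-query bounded-error algorithm for f, so
-- Q(f) ≥ r says that r bounds every such t from below.
Q[_]≥_ : ∀ {N} → (Input N → Bool) → ℝ → Set
Q[_]≥_ {N} f r =
  ∀ t (A : Algorithm N t) → ComputesBoundedError A f → r ≤ℝ fromℕ t

record Graph (n : ℕ) : Set where
  field
    adj    : Fin n → Fin n → Bool
    symm   : ∀ u v → adj u v ≡ adj v u
    irrefl : ∀ v → adj v v ≡ false

open Graph public

Edge : ∀ {n} → Graph n → Fin n → Fin n → Set
Edge G u v = T (adj G u v)

HasEdge : ∀ {n} → Graph n → Set
HasEdge G = ∃ λ u → ∃ λ v → Edge G u v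

IsHom : ∀ {m n} → Graph m → Graph n → (Fin m → Fin n) → Set
IsHom H G h = ∀ u v → Edge H u v → Edge G (h u) (h v)

Hom : ∀ {m n} → Graph m → Graph n → Set
Hom {m} {n} H G = Σ (Fin m → Fin n) (IsHom H G)

anyVec? : ∀ {k m} {P : Vec (Fin k) m → Set} → Decidable P → Dec (∃ P)
anyVec? {m = zero}  P? = map′ (λ p → [] , p) (λ { ([] , p) → p }) (P? [])
anyVec? {m = suc m} P? =
  map′ (λ { (a , v , p) → a ∷ v , p }) (λ { (a ∷ v , p) → a , v , p })
    (Fin.any? λ a → anyVec? λ v → P? (a ∷ v))

isHom? : ∀ {m n} (H : Graph m) (G : Graph n) → Decidable (IsHom H G)
isHom? H G h =
  Fin.all? λ u → Fin.all? λ v → T? (adj H u v) →-dec T? (adj G (h u) (h v))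

hom? : ∀ {m n} (H : Graph m) (G : Graph n) → Dec (Hom H G)
hom? H G = map′
  (λ { (v , p) → lookup v , p })
  (λ { (h , p) → tabulate h , λ u v e →
         subst₂ (Edge G) (sym (lookup∘tabulate h u)) (sym (lookup∘tabulate h v)) (p u v e) })
  (anyVec? (isHom? H G ∘ lookup))

-- Number of unordered pairs of distinct vertices, in a form that computes:
-- vertex 0 lies in n pairs, and the others avoid it.
pairs : ℕ → ℕ
pairs zero    = 0
pairs (suc n) = n ℕ.+ pairs n

pairs≡nC2 : ∀ n → pairs n ≡ n C 2
pairs≡nC2 zero    = refl
pairs≡nC2 (suc n) =
  trans (cong₂ ℕ._+_ (sym (nC1≡n n)) (pairs≡nC2 n)) (nCk+nC[k+1]≡[n+1]C[k+1] n 1)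

-- Pairs are ordered lexicographically: {0,1}, …, {0,n-1}, {1,2}, …
bit : ∀ n → Input (pairs n) → Fin n → Fin n → Bool
bit (suc n) x zero    zero    = false
bit (suc n) x zero    (suc v) = x (v ↑ˡ pairs n)
bit (suc n) x (suc u) zero    = x (u ↑ˡ pairs n)
bit (suc n) x (suc u) (suc v) = bit n (λ e → x (n ↑ʳ e)) u v

bit-symm : ∀ n (x : Input (pairs n)) u v → bit n x u v ≡ bit n x v u
bit-symm (suc n) x zero    zero    = refl
bit-symm (suc n) x zero    (suc v) = refl
bit-symm (suc n) x (suc u) zero    = refl
bit-symm (suc n) x (suc u) (suc v) = bit-symm n (λ e → x (n ↑ʳ e)) u v

bit-irrefl : ∀ n (x : Input (pairs n)) v → bit n x v v ≡ false
bit-irrefl (suc n) x zero    = refl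
bit-irrefl (suc n) x (suc v) = bit-irrefl n (λ e → x (n ↑ʳ e)) v

graph : ∀ n → Input (pairs n) → Graph n
graph n x = record { adj = bit n x ; symm = bit-symm n x ; irrefl = bit-irrefl n x }

f[_] : ∀ {n} → Graph n → Input (pairs n) → Bool
f[_] {n} H x = does (hom? H (graph n x))

{-# OPTIONS --safe #-}
module Submission where

-- Let k be the chromatic number of H. The complete graph on k of the n
-- vertices is a positive input that becomes negative when any of its edges is
-- removed; the join of a complete graph on k - 2 vertices with an edgeless graph
-- on the other n - k + 2 is a negative input that becomes positive when any
-- edge is added. So some input has about max(k, n - k + 2)² / 2 sensitive bits.
--
-- A t-query algorithm has sensitivity O(t²) by the hybrid argument: if ψ
-- and φᵢ are its states on x and on x with bit i flipped, then the sum over i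
-- of ‖ψ - φᵢ‖² is at most 4s(s + 1) after s queries, because the step
--   k‖a + b‖² ≤ (k + 1)‖a‖² + k(k + 1)‖b‖²   (k = s + 1)
-- applies to the old error a and the new error b = Oψ - Oᵢψ of the next
-- query, and the new errors have total squared length at most 4‖ψ‖² = 4. At a
-- sensitive bit i bounded error forces ‖ψ - φᵢ‖² ≥ 1/18 at the end.

open import Defs
open import Algebra.Bundles using (CommutativeMonoid)
open import Data.Bool.Base using (Bool; true; false; not; if_then_else_; _xor_; T)
import Data.Bool.Properties as Bool
open import Data.Empty using (⊥-elim)
open import Data.Fin.Base using (Fin; zero; suc; _↑ˡ_; _↑ʳ_; splitAt; punchOut)
import Data.Fin.Properties as Fin
import Data.Integer.Base as ℤ
import Data.Integer.Properties as ℤ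
open import Data.Nat.Base as ℕ using (ℕ; zero; suc; _⊔_)
import Data.Nat.Properties as ℕ
open import Data.Nat.Solver using () renaming (module +-*-Solver to ℕ-Solver)
open import Data.Product.Base using (∃; _×_; _,_; proj₁; proj₂)
open import Data.Rational.Base using (ℚ; 0ℚ; 1ℚ; ½; _+_; _*_; -_; _-_; ∣_∣; _≤_; _<_; _/_; positive; nonNegative; nonPositive; toℚᵘ)
import Data.Rational.Properties as ℚ
open import Data.Rational.Solver using (module +-*-Solver)
open import Data.Rational.Unnormalised.Base as ℚᵘ using (mkℚᵘ; *≡*; *≤*)
import Data.Rational.Unnormalised.Properties as ℚᵘ
open import Data.Sum.Base using (inj₁; inj₂)
open import Data.Unit.Base using (⊤; tt)
open import Data.Vec.Base as Vec using (Vec; []; _∷_)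
open import Data.Vec.Functional using (foldr; updateAt; _++_)
open import Data.Vec.Functional.Properties using (updateAt-updates; updateAt-minimal; lookup-++ˡ; lookup-++ʳ)
open import Function.Base using (_∘_)
open import Level using (0ℓ)
open import Relation.Binary.Bundles using (Preorder)
open import Relation.Binary.PropositionalEquality using (_≡_; _≢_; refl; sym; trans; cong; cong₂; subst)
import Relation.Binary.Reasoning.Preorder as ≲-Reasoning
import Relation.Binary.Reasoning.Setoid as ≈-Reasoning
open import Relation.Nullary.Decidable using (Dec; does; yes; no; dec-true; dec-false)
open import Relation.Nullary.Negation using (¬_; contradiction)
open import Relation.Unary using (Decidable)

-- Finite sums

-- Two carriers are allowed, so that congruence, monotonicity and, with `B = ⊤`, the vanishing of a
-- sum are all instances.
foldr-preserves : ∀ {A B : Set} (R : A → B → Set) {_⊕_ : A → A → A} {_⊕′_ : B → B → B} {e e′} →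
  R e e′ → (∀ {a b c d} → R a b → R c d → R (a ⊕ c) (b ⊕′ d)) →
  ∀ {n} {f : Fin n → A} {g : Fin n → B} → (∀ i → R (f i) (g i)) →
  R (foldr _⊕_ e f) (foldr _⊕′_ e′ g)
foldr-preserves R base step {zero}  h = base
foldr-preserves R base step {suc n} h = step (h zero) (foldr-preserves R base step (λ i → h (suc i)))

sumOver-preserves : ∀ {A B : Set} (R : A → B → Set) {_⊕_ : A → A → A} {_⊕′_ : B → B → B} {e e′} →
  R e e′ → (∀ {a b c d} → R a b → R c d → R (a ⊕ c) (b ⊕′ d)) →
  ∀ {N W} {f : Basis N W → A} {g : Basis N W → B} → (∀ a → R (f a) (g a)) →
  R (sumOver _⊕_ e f) (sumOver _⊕′_ e′ g)
sumOver-preserves R base step h = foldr-preserves R base step λ i →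
  step (foldr-preserves R base step λ w → h (i , false , w))
       (foldr-preserves R base step λ w → h (i , true  , w))

module Sums (M : CommutativeMonoid 0ℓ 0ℓ) where
  open CommutativeMonoid M renaming (refl to ≈-refl; sym to ≈-sym; trans to ≈-trans)

  ∑ᶠ : ∀ {n} → (Fin n → Carrier) → Carrier
  ∑ᶠ = foldr _∙_ ε

  ∑ᴮ : ∀ {N W} → (Basis N W → Carrier) → Carrier
  ∑ᴮ = sumOver _∙_ ε

  ∑ᶠ-cong : ∀ {n} {f g : Fin n → Carrier} → (∀ i → f i ≈ g i) → ∑ᶠ f ≈ ∑ᶠ g
  ∑ᶠ-cong = foldr-preserves _≈_ ≈-refl ∙-cong

  ∑ᴮ-cong : ∀ {N W} {f g : Basis N W → Carrier} → (∀ a → f a ≈ g a) → ∑ᴮ f ≈ ∑ᴮ g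
  ∑ᴮ-cong = sumOver-preserves _≈_ ≈-refl ∙-cong

  -- An additive functional of a family of summands commutes with sums. With
  -- the family indexed by ⊤, Bool or a basis this covers additive maps,
  -- termwise addition or subtraction, and the interchange of two sums.
  module Additive {A B : Set} {_⊕_ : B → B → B} {e : B} (L : (A → B) → Carrier)
    (L-zero : L (λ _ → e) ≈ ε) (L-add : ∀ f g → L (λ a → f a ⊕ g a) ≈ L f ∙ L g) where

    ∑ᶠ-additive : ∀ {n} (g : Fin n → A → B) →
      L (λ a → foldr _⊕_ e (λ i → g i a)) ≈ ∑ᶠ (λ i → L (g i))
    ∑ᶠ-additive {zero}  g = L-zero
    ∑ᶠ-additive {suc n} g = ≈-trans
      (L-add (g zero) (λ a → foldr _⊕_ e (λ i → g (suc i) a)))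
      (∙-congˡ (∑ᶠ-additive (λ i → g (suc i))))

    ∑ᴮ-additive : ∀ {N W} (g : Basis N W → A → B) →
      L (λ a → sumOver _⊕_ e (λ b → g b a)) ≈ ∑ᴮ (λ b → L (g b))
    ∑ᴮ-additive g = ≈-trans
      (∑ᶠ-additive (λ i a → foldr _⊕_ e (λ w → g (i , false , w) a) ⊕ foldr _⊕_ e (λ w → g (i , true , w) a)))
      (∑ᶠ-cong λ i → ≈-trans
        (L-add (λ a → foldr _⊕_ e (λ w → g (i , false , w) a)) (λ a → foldr _⊕_ e (λ w → g (i , true , w) a)))
        (∙-cong (∑ᶠ-additive (λ w → g (i , false , w))) (∑ᶠ-additive (λ w → g (i , true , w)))))

  interchange : ∀ a b c d → (a ∙ b) ∙ (c ∙ d) ≈ (a ∙ c) ∙ (b ∙ d)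
  interchange a b c d = begin
    (a ∙ b) ∙ (c ∙ d) ≈⟨ assoc a b (c ∙ d) ⟩
    a ∙ (b ∙ (c ∙ d)) ≈⟨ ∙-congˡ (assoc b c d) ⟨
    a ∙ ((b ∙ c) ∙ d) ≈⟨ ∙-congˡ (∙-congʳ (comm b c)) ⟩
    a ∙ ((c ∙ b) ∙ d) ≈⟨ ∙-congˡ (assoc c b d) ⟩
    a ∙ (c ∙ (b ∙ d)) ≈⟨ assoc a c (b ∙ d) ⟨
    (a ∙ c) ∙ (b ∙ d) ∎
    where open ≈-Reasoning setoid

  private
    module Pair = Additive {A = Bool} {_⊕_ = _∙_} {e = ε} (λ p → p false ∙ p true)
      (identityˡ ε) (λ f g → interchange (f false) (g false) (f true) (g true))

  ∑ᶠ-∙ : ∀ {n} (f g : Fin n → Carrier) → ∑ᶠ f ∙ ∑ᶠ g ≈ ∑ᶠ (λ i → f i ∙ g i)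
  ∑ᶠ-∙ f g = Pair.∑ᶠ-additive (λ i t → if t then g i else f i)

  ∑ᴮ-∙ : ∀ {N W} (f g : Basis N W → Carrier) → ∑ᴮ f ∙ ∑ᴮ g ≈ ∑ᴮ (λ a → f a ∙ g a)
  ∑ᴮ-∙ f g = Pair.∑ᴮ-additive (λ a t → if t then g a else f a)

  ∑ᶠ-zero : ∀ {n} {f : Fin n → Carrier} → (∀ i → f i ≈ ε) → ∑ᶠ f ≈ ε
  ∑ᶠ-zero = foldr-preserves (λ a (_ : ⊤) → a ≈ ε) {_⊕′_ = λ _ _ → tt} {e′ = tt} ≈-refl
    (λ p q → ≈-trans (∙-cong p q) (identityˡ ε)) {g = λ _ → tt}

  ∑ᴮ-zero : ∀ {N W} {f : Basis N W → Carrier} → (∀ a → f a ≈ ε) → ∑ᴮ f ≈ ε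
  ∑ᴮ-zero = sumOver-preserves (λ a (_ : ⊤) → a ≈ ε) {_⊕′_ = λ _ _ → tt} {e′ = tt} ≈-refl
    (λ p q → ≈-trans (∙-cong p q) (identityˡ ε)) {g = λ _ → tt}

  ∑ᴮ-swap : ∀ {N W N′ W′} (g : Basis N W → Basis N′ W′ → Carrier) →
    ∑ᴮ (λ a → ∑ᴮ (λ b → g a b)) ≈ ∑ᴮ (λ b → ∑ᴮ (λ a → g a b))
  ∑ᴮ-swap {N} {W} g = Additive.∑ᴮ-additive {A = Basis N W} ∑ᴮ
    (∑ᴮ-zero {N} {W} (λ _ → ≈-refl)) (λ f h → ≈-sym (∑ᴮ-∙ f h)) (λ b a → g a b)

  ∑ᶠ-single : ∀ {n} (j : Fin n) {f : Fin n → Carrier} → (∀ i → i ≢ j → f i ≈ ε) → ∑ᶠ f ≈ f j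
  ∑ᶠ-single zero    h = ≈-trans (∙-congˡ (∑ᶠ-zero λ i → h (suc i) λ ())) (identityʳ _)
  ∑ᶠ-single (suc j) h = ≈-trans
    (∙-cong (h zero λ ()) (∑ᶠ-single j λ i i≢j → h (suc i) (i≢j ∘ Fin.suc-injective)))
    (identityˡ _)

  ∑ᴮ-single : ∀ {N W} (b : Basis N W) {f : Basis N W → Carrier} →
    (∀ a → a ≢ b → f a ≈ ε) → ∑ᴮ f ≈ f b
  ∑ᴮ-single b@(j , t , v) {f} h = ≈-trans
    (∑ᶠ-single j λ i i≢j → ≈-trans
      (∙-cong (∑ᶠ-zero λ w → h (i , false , w) λ { refl → i≢j refl })
              (∑ᶠ-zero λ w → h (i , true  , w) λ { refl → i≢j refl }))
      (identityˡ ε))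
    (block t h)
    where
    block : ∀ t → (∀ a → a ≢ (j , t , v) → f a ≈ ε) →
      ∑ᶠ (λ w → f (j , false , w)) ∙ ∑ᶠ (λ w → f (j , true , w)) ≈ f (j , t , v)
    block false h = ≈-trans
      (∙-cong (∑ᶠ-single v λ w w≢v → h (j , false , w) λ { refl → w≢v refl })
              (∑ᶠ-zero λ w → h (j , true , w) λ ()))
      (identityʳ _)
    block true h = ≈-trans
      (∙-cong (∑ᶠ-zero λ w → h (j , false , w) λ ())
              (∑ᶠ-single v λ w w≢v → h (j , true , w) λ { refl → w≢v refl }))
      (identityˡ _)

-- Real numbers

module ℚ-Identities where
  open +-*-Solver

  telescope : ∀ a b c → a - c ≡ (a - b) + (b - c)
  telescope = solve 3 (λ a b c → a :- c := (a :- b) :+ (b :- c)) refl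

  neg-minus : ∀ a b → - (a - b) ≡ b - a
  neg-minus = solve 2 (λ a b → :- (a :- b) := b :- a) refl

  plus-minus : ∀ a b c d → (a + b) - (c + d) ≡ (a - c) + (b - d)
  plus-minus = solve 4 (λ a b c d → (a :+ b) :- (c :+ d) := (a :- c) :+ (b :- d)) refl

  minus-plus : ∀ a b → a ≡ b + (a - b)
  minus-plus = solve 2 (λ a b → a := b :+ (a :- b)) refl

  shuffle : ∀ a b c d → (a + b) + (c + d) ≡ (a + c) + (b + d)
  shuffle = solve 4 (λ a b c d → (a :+ b) :+ (c :+ d) := (a :+ c) :+ (b :+ d)) refl

  neg-minus-neg : ∀ a b → - a - - b ≡ - (a - b)
  neg-minus-neg = solve 2 (λ a b → :- a :- :- b := :- (a :- b)) refl

open ℚ-Identities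

half>0 : ∀ {ε} → 0ℚ < ε → 0ℚ < ½ * ε
half>0 {ε} ε>0 = ℚ.positive⁻¹ (½ * ε) {{ℚ.pos*pos⇒pos ½ ε {{positive ε>0}}}}

half+half : ∀ ε → ½ * ε + ½ * ε ≡ ε
half+half ε = trans (sym (ℚ.*-distribʳ-+ ε ½ ½)) (ℚ.*-identityˡ ε)

-- The relations of Defs unfold to types from which Agda cannot recover the
-- related numbers; the record wrappers let implicit arguments be inferred.

infix 4 _≃_ _≲_ _≃ᶜ_

record _≃_ (x y : ℝ) : Set where
  constructor wrap≃
  field unwrap≃ : x ≈ℝ y

record _≲_ (x y : ℝ) : Set where
  constructor wrap≲
  field unwrap≲ : x ≤ℝ y
open _≲_

pointwise-≃ : ∀ {x y} → (∀ n → seq x n ≡ seq y n) → x ≃ y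
pointwise-≃ {x} {y} h = wrap≃ λ ε ε>0 → 0 , λ n _ → ℚ.≤-trans
  (ℚ.≤-reflexive (cong ∣_∣ (trans (cong (_- seq y n) (h n)) (ℚ.+-inverseʳ (seq y n)))))
  (ℚ.<⇒≤ ε>0)

pointwise-≲ : ∀ {x y} → (∀ n → seq x n ≤ seq y n) → x ≲ y
pointwise-≲ {x} {y} h = wrap≲ λ ε ε>0 → 0 , λ n _ →
  ℚ.≤-trans (ℚ.≤-reflexive (sym (ℚ.+-identityʳ (seq x n)))) (ℚ.+-mono-≤ (h n) (ℚ.<⇒≤ ε>0))

≃-refl : ∀ {x} → x ≃ x
≃-refl = pointwise-≃ λ _ → refl

≃-sym : ∀ {x y} → x ≃ y → y ≃ x
≃-sym {x} {y} (wrap≃ h) = wrap≃ λ ε ε>0 → let N , p = h ε ε>0 in N , λ n N≤n → begin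
  ∣ seq y n - seq x n ∣      ≡⟨ cong ∣_∣ (neg-minus (seq x n) (seq y n)) ⟨
  ∣ - (seq x n - seq y n) ∣  ≡⟨ ℚ.∣-p∣≡∣p∣ (seq x n - seq y n) ⟩
  ∣ seq x n - seq y n ∣      ≤⟨ p n N≤n ⟩
  ε                          ∎
  where open ℚ.≤-Reasoning

≃-trans : ∀ {x y z} → x ≃ y → y ≃ z → x ≃ z
≃-trans {x} {y} {z} (wrap≃ g) (wrap≃ h) = wrap≃ λ ε ε>0 →
  let M , p = g (½ * ε) (half>0 ε>0)
      N , q = h (½ * ε) (half>0 ε>0)
  in M ⊔ N , λ n le → begin
  ∣ seq x n - seq z n ∣
    ≡⟨ cong ∣_∣ (telescope (seq x n) (seq y n) (seq z n)) ⟩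
  ∣ (seq x n - seq y n) + (seq y n - seq z n) ∣
    ≤⟨ ℚ.∣p+q∣≤∣p∣+∣q∣ (seq x n - seq y n) (seq y n - seq z n) ⟩
  ∣ seq x n - seq y n ∣ + ∣ seq y n - seq z n ∣
    ≤⟨ ℚ.+-mono-≤ (p n (ℕ.m⊔n≤o⇒m≤o M N le)) (q n (ℕ.m⊔n≤o⇒n≤o M N le)) ⟩
  ½ * ε + ½ * ε
    ≡⟨ half+half ε ⟩
  ε ∎
  where open ℚ.≤-Reasoning

+-cong : ∀ {a b c d} → a ≃ b → c ≃ d → a +ℝ c ≃ b +ℝ d
+-cong {a} {b} {c} {d} (wrap≃ g) (wrap≃ h) = wrap≃ λ ε ε>0 →
  let M , p = g (½ * ε) (half>0 ε>0)
      N , q = h (½ * ε) (half>0 ε>0)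
  in M ⊔ N , λ n le → begin
  ∣ (seq a n + seq c n) - (seq b n + seq d n) ∣
    ≡⟨ cong ∣_∣ (plus-minus (seq a n) (seq c n) (seq b n) (seq d n)) ⟩
  ∣ (seq a n - seq b n) + (seq c n - seq d n) ∣
    ≤⟨ ℚ.∣p+q∣≤∣p∣+∣q∣ (seq a n - seq b n) (seq c n - seq d n) ⟩
  ∣ seq a n - seq b n ∣ + ∣ seq c n - seq d n ∣
    ≤⟨ ℚ.+-mono-≤ (p n (ℕ.m⊔n≤o⇒m≤o M N le)) (q n (ℕ.m⊔n≤o⇒n≤o M N le)) ⟩
  ½ * ε + ½ * ε
    ≡⟨ half+half ε ⟩
  ε ∎
  where open ℚ.≤-Reasoning

neg-cong : ∀ {a b} → a ≃ b → -ℝ a ≃ -ℝ b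
neg-cong {a} {b} (wrap≃ g) = wrap≃ λ ε ε>0 → let N , p = g ε ε>0 in N , λ n N≤n → begin
  ∣ - seq a n - - seq b n ∣  ≡⟨ cong ∣_∣ (neg-minus-neg (seq a n) (seq b n)) ⟩
  ∣ - (seq a n - seq b n) ∣  ≡⟨ ℚ.∣-p∣≡∣p∣ (seq a n - seq b n) ⟩
  ∣ seq a n - seq b n ∣      ≤⟨ p n N≤n ⟩
  ε                          ∎
  where open ℚ.≤-Reasoning

-- By a c - b d = a (c - d) + d (a - b), eventual bounds on `a` and `d` suffice; the sum of these
-- bounds fixes the tolerance δ asked of the two factors.
*-cong : ∀ {a b c d} → a ≃ b → c ≃ d → a *ℝ c ≃ b *ℝ d
*-cong {a} {b} {c} {d} (wrap≃ g) (wrap≃ h) = wrap≃ λ ε ε>0 →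
  let A , A>0 , K , boundA = cauchy-bound {seq a} (cauchy a)
      D , D>0 , L , boundD = cauchy-bound {seq d} (cauchy d)
      δ , δ>0 , Sδ≡ε = divide (A + D) ε (ℚ.+-mono-< A>0 D>0) ε>0
      M , p = g δ δ>0
      N , q = h δ δ>0
  in (K ⊔ L) ⊔ (M ⊔ N) , λ n le →
    let le₁ = ℕ.m⊔n≤o⇒m≤o (K ⊔ L) (M ⊔ N) le
        le₂ = ℕ.m⊔n≤o⇒n≤o (K ⊔ L) (M ⊔ N) le
    in ℚ.≤-trans
      (mul-step (seq a n) (seq c n) (seq b n) (seq d n) (ℚ.<⇒≤ δ>0)
        (boundA n (ℕ.m⊔n≤o⇒m≤o K L le₁)) (boundD n (ℕ.m⊔n≤o⇒n≤o K L le₁))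
        (q n (ℕ.m⊔n≤o⇒n≤o M N le₂)) (p n (ℕ.m⊔n≤o⇒m≤o M N le₂)))
      (ℚ.≤-reflexive Sδ≡ε)

≃⇒≲ : ∀ {x y} → x ≃ y → x ≲ y
≃⇒≲ {x} {y} (wrap≃ h) = wrap≲ λ ε ε>0 → let N , p = h ε ε>0 in N , λ n N≤n → begin
  seq x n                        ≡⟨ minus-plus (seq x n) (seq y n) ⟩
  seq y n + (seq x n - seq y n)  ≤⟨ ℚ.+-monoʳ-≤ (seq y n) (ℚ.≤-trans (p≤∣p∣ (seq x n - seq y n)) (p n N≤n)) ⟩
  seq y n + ε                    ∎
  where
  open ℚ.≤-Reasoning
  p≤∣p∣ : ∀ p → p ≤ ∣ p ∣
  p≤∣p∣ p with ℚ.≤-total 0ℚ p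
  ... | inj₁ 0≤p = ℚ.≤-reflexive (sym (ℚ.0≤p⇒∣p∣≡p 0≤p))
  ... | inj₂ p≤0 = ℚ.≤-trans p≤0 (ℚ.0≤∣p∣ p)

≲-refl : ∀ {x} → x ≲ x
≲-refl = pointwise-≲ λ _ → ℚ.≤-refl

≲-trans : ∀ {x y z} → x ≲ y → y ≲ z → x ≲ z
≲-trans {x} {y} {z} (wrap≲ g) (wrap≲ h) = wrap≲ λ ε ε>0 →
  let M , p = g (½ * ε) (half>0 ε>0)
      N , q = h (½ * ε) (half>0 ε>0)
  in M ⊔ N , λ n le → begin
  seq x n
    ≤⟨ p n (ℕ.m⊔n≤o⇒m≤o M N le) ⟩
  seq y n + ½ * ε
    ≤⟨ ℚ.+-monoˡ-≤ (½ * ε) (q n (ℕ.m⊔n≤o⇒n≤o M N le)) ⟩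
  (seq z n + ½ * ε) + ½ * ε
    ≡⟨ ℚ.+-assoc (seq z n) (½ * ε) (½ * ε) ⟩
  seq z n + (½ * ε + ½ * ε)
    ≡⟨ cong (seq z n +_) (half+half ε) ⟩
  seq z n + ε ∎
  where open ℚ.≤-Reasoning

+-mono : ∀ {a b c d} → a ≲ b → c ≲ d → a +ℝ c ≲ b +ℝ d
+-mono {a} {b} {c} {d} (wrap≲ g) (wrap≲ h) = wrap≲ λ ε ε>0 →
  let M , p = g (½ * ε) (half>0 ε>0)
      N , q = h (½ * ε) (half>0 ε>0)
  in M ⊔ N , λ n le → begin
  seq a n + seq c n
    ≤⟨ ℚ.+-mono-≤ (p n (ℕ.m⊔n≤o⇒m≤o M N le)) (q n (ℕ.m⊔n≤o⇒n≤o M N le)) ⟩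
  (seq b n + ½ * ε) + (seq d n + ½ * ε)
    ≡⟨ shuffle (seq b n) (½ * ε) (seq d n) (½ * ε) ⟩
  (seq b n + seq d n) + (½ * ε + ½ * ε)
    ≡⟨ cong (seq b n + seq d n +_) (half+half ε) ⟩
  (seq b n + seq d n) + ε ∎
  where open ℚ.≤-Reasoning

infixr 7 _·_

_·_ : ℚ → ℝ → ℝ
q · x = fromℚ q *ℝ x

·-mono : ∀ {q x y} → 0ℚ < q → x ≲ y → q · x ≲ q · y
·-mono {q} {x} {y} q>0 (wrap≲ h) = wrap≲ λ ε ε>0 →
  let δ , δ>0 , qδ≡ε = divide q ε q>0 ε>0
      N , p = h δ δ>0
  in N , λ n N≤n → begin
  q * seq x n        ≤⟨ ℚ.*-monoˡ-≤-nonNeg q {{nonNegative (ℚ.<⇒≤ q>0)}} (p n N≤n) ⟩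
  q * (seq y n + δ)  ≡⟨ ℚ.*-distribˡ-+ q (seq y n) δ ⟩
  q * seq y n + q * δ ≡⟨ cong (q * seq y n +_) qδ≡ε ⟩
  q * seq y n + ε    ∎
  where open ℚ.≤-Reasoning

·-cancel : ∀ {q x y} → 0ℚ < q → q · x ≲ q · y → x ≲ y
·-cancel {q} {x} {y} q>0 (wrap≲ h) = wrap≲ λ ε ε>0 →
  let N , p = h (q * ε) (ℚ.positive⁻¹ (q * ε) {{ℚ.pos*pos⇒pos q {{positive q>0}} ε {{positive ε>0}}}})
  in N , λ n N≤n → ℚ.*-cancelˡ-≤-pos q {{positive q>0}} (begin
  q * seq x n          ≤⟨ p n N≤n ⟩
  q * seq y n + q * ε  ≡⟨ ℚ.*-distribˡ-+ q (seq y n) ε ⟨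
  q * (seq y n + ε)    ∎)
  where open ℚ.≤-Reasoning

+-cancelˡ : ∀ {x y z} → x +ℝ y ≲ x +ℝ z → y ≲ z
+-cancelˡ {x} {y} {z} (wrap≲ h) = wrap≲ λ ε ε>0 → let N , p = h ε ε>0 in N , λ n N≤n →
  ℚ.≤-trans (ℚ.≤-reflexive (undo (seq x n) (seq y n)))
    (ℚ.≤-trans (ℚ.+-monoʳ-≤ (- seq x n) (p n N≤n))
      (ℚ.≤-reflexive (redo (seq x n) (seq z n) ε)))
  where
  open +-*-Solver
  undo : ∀ a b → b ≡ - a + (a + b)
  undo = solve 2 (λ a b → b := :- a :+ (a :+ b)) refl
  redo : ∀ a b c → - a + ((a + b) + c) ≡ b + c
  redo = solve 3 (λ a b c → :- a :+ ((a :+ b) :+ c) := b :+ c) refl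

-- If `q < p`, half the gap serves as tolerance: `p` would then be at most the midpoint of `q` and
-- `p`, which lies strictly below `p`.
fromℚ-reflects-≤ : ∀ {p q} → fromℚ p ≲ fromℚ q → p ≤ q
fromℚ-reflects-≤ {p} {q} (wrap≲ h) = ℚ.≮⇒≥ λ q<p →
  let δ>0 = ℚ.<-respˡ-≡ (ℚ.+-inverseʳ q) (ℚ.+-monoˡ-< (- q) q<p)
      N , r = h (½ * (p - q)) (half>0 δ>0)
  in ℚ.<-irrefl refl (ℚ.<-≤-trans (strict q<p) (r N ℕ.≤-refl))
  where
  open +-*-Solver
  mid : ∀ p q → p ≡ (q + ½ * (p - q)) + ½ * (p - q)
  mid = solve 2 (λ p q → p := (q :+ con ½ :* (p :- q)) :+ con ½ :* (p :- q)) refl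
  strict : q < p → q + ½ * (p - q) < p
  strict q<p = ℚ.<-≤-trans
    (ℚ.<-respˡ-≡ (ℚ.+-identityʳ _) (ℚ.+-monoʳ-< (q + ½ * (p - q))
      (half>0 (ℚ.<-respˡ-≡ (ℚ.+-inverseʳ q) (ℚ.+-monoˡ-< (- q) q<p)))))
    (ℚ.≤-reflexive (sym (mid p q)))

ℝ-+-commutativeMonoid : CommutativeMonoid 0ℓ 0ℓ
ℝ-+-commutativeMonoid = record
  { Carrier = ℝ ; _≈_ = _≃_ ; _∙_ = _+ℝ_ ; ε = 0ℝ
  ; isCommutativeMonoid = record
    { isMonoid = record
      { isSemigroup = record
        { isMagma = record
          { isEquivalence = record { refl = ≃-refl ; sym = ≃-sym ; trans = ≃-trans }
          ; ∙-cong = +-cong }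
        ; assoc = λ x y z → pointwise-≃ λ n → ℚ.+-assoc (seq x n) (seq y n) (seq z n) }
      ; identity = (λ x → pointwise-≃ λ n → ℚ.+-identityˡ (seq x n))
                 , (λ x → pointwise-≃ λ n → ℚ.+-identityʳ (seq x n)) }
    ; comm = λ x y → pointwise-≃ λ n → ℚ.+-comm (seq x n) (seq y n) } }

≲-preorder : Preorder 0ℓ 0ℓ 0ℓ
≲-preorder = record
  { Carrier = ℝ ; _≈_ = _≃_ ; _≲_ = _≲_
  ; isPreorder = record
    { isEquivalence = CommutativeMonoid.isEquivalence ℝ-+-commutativeMonoid
    ; reflexive = ≃⇒≲
    ; trans = ≲-trans } }

-- Complex numbers

record _≃ᶜ_ (z w : ℂ) : Set where
  constructor wrap≃ᶜ
  field
    re-≃ : re z ≃ re w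
    im-≃ : im z ≃ im w
open _≃ᶜ_

pointwise-≃ᶜ : ∀ {z w} → (∀ n → seq (re z) n ≡ seq (re w) n) → (∀ n → seq (im z) n ≡ seq (im w) n) → z ≃ᶜ w
pointwise-≃ᶜ p q = wrap≃ᶜ (pointwise-≃ p) (pointwise-≃ q)

≃ᶜ-refl : ∀ {z} → z ≃ᶜ z
≃ᶜ-refl = wrap≃ᶜ ≃-refl ≃-refl

ℂ-+-commutativeMonoid : CommutativeMonoid 0ℓ 0ℓ
ℂ-+-commutativeMonoid = record
  { Carrier = ℂ ; _≈_ = _≃ᶜ_ ; _∙_ = _+ℂ_ ; ε = 0ℂ
  ; isCommutativeMonoid = record
    { isMonoid = record
      { isSemigroup = record
        { isMagma = record
          { isEquivalence = record
            { refl = ≃ᶜ-refl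
            ; sym = λ (wrap≃ᶜ p q) → wrap≃ᶜ (≃-sym p) (≃-sym q)
            ; trans = λ (wrap≃ᶜ p q) (wrap≃ᶜ r s) → wrap≃ᶜ (≃-trans p r) (≃-trans q s) }
          ; ∙-cong = λ (wrap≃ᶜ p q) (wrap≃ᶜ r s) → wrap≃ᶜ (+-cong p r) (+-cong q s) }
        ; assoc = λ x y z → wrap≃ᶜ (R.assoc (re x) (re y) (re z)) (R.assoc (im x) (im y) (im z)) }
      ; identity = (λ x → wrap≃ᶜ (R.identityˡ (re x)) (R.identityˡ (im x)))
                 , (λ x → wrap≃ᶜ (R.identityʳ (re x)) (R.identityʳ (im x))) }
    ; comm = λ x y → wrap≃ᶜ (R.comm (re x) (re y)) (R.comm (im x) (im y)) } }
  where module R = CommutativeMonoid ℝ-+-commutativeMonoid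

open CommutativeMonoid ℂ-+-commutativeMonoid using () renaming (trans to ≃ᶜ-trans; sym to ≃ᶜ-sym)

*ᶜ-cong : ∀ {a b c d} → a ≃ᶜ b → c ≃ᶜ d → a *ℂ c ≃ᶜ b *ℂ d
*ᶜ-cong (wrap≃ᶜ p q) (wrap≃ᶜ r s) = wrap≃ᶜ
  (+-cong (*-cong p r) (neg-cong (*-cong q s)))
  (+-cong (*-cong p s) (*-cong q r))

infixl 6 _-ℂ_

_-ℂ_ : ℂ → ℂ → ℂ
z -ℂ w = (re z -ℝ re w) +i (im z -ℝ im w)

∣∣²-cong : ∀ {z w} → z ≃ᶜ w → ∣ z ∣² ≃ ∣ w ∣²
∣∣²-cong (wrap≃ᶜ p q) = +-cong (*-cong p p) (*-cong q q)

module ℂ-Identities where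
  open +-*-Solver public

  -- Real and imaginary parts as polynomials, so that complex identities can be written with complex
  -- operations while the ring solver checks each part.
  Expr : ℕ → Set
  Expr n = Polynomial n × Polynomial n

  _⊞_ _⊠_ _⊟_ : ∀ {n} → Expr n → Expr n → Expr n
  (a , b) ⊞ (c , d) = a :+ c , b :+ d
  (a , b) ⊟ (c , d) = a :- c , b :- d
  (a , b) ⊠ (c , d) = a :* c :- b :* d , a :* d :+ b :* c

  bar : ∀ {n} → Expr n → Expr n
  bar (a , b) = a , :- b

module Identities where
  open ℂ-Identities

  *ᶜ-distribʳ-+ : ∀ x y z → (x +ℂ y) *ℂ z ≃ᶜ x *ℂ z +ℂ y *ℂ z
  *ᶜ-distribʳ-+ x y z = pointwise-≃ᶜ
    (λ n → solve 6 (λ a b c d e f → proj₁ (((a , b) ⊞ (c , d)) ⊠ (e , f)) := proj₁ (((a , b) ⊠ (e , f)) ⊞ ((c , d) ⊠ (e , f)))) refl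
      (seq (re x) n) (seq (im x) n) (seq (re y) n) (seq (im y) n) (seq (re z) n) (seq (im z) n))
    (λ n → solve 6 (λ a b c d e f → proj₂ (((a , b) ⊞ (c , d)) ⊠ (e , f)) := proj₂ (((a , b) ⊠ (e , f)) ⊞ ((c , d) ⊠ (e , f)))) refl
      (seq (re x) n) (seq (im x) n) (seq (re y) n) (seq (im y) n) (seq (re z) n) (seq (im z) n))

  *ᶜ-comm : ∀ x y → x *ℂ y ≃ᶜ y *ℂ x
  *ᶜ-comm x y = pointwise-≃ᶜ
    (λ n → solve 4 (λ a b c d → proj₁ ((a , b) ⊠ (c , d)) := proj₁ ((c , d) ⊠ (a , b))) refl
      (seq (re x) n) (seq (im x) n) (seq (re y) n) (seq (im y) n))
    (λ n → solve 4 (λ a b c d → proj₂ ((a , b) ⊠ (c , d)) := proj₂ ((c , d) ⊠ (a , b))) refl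
      (seq (re x) n) (seq (im x) n) (seq (re y) n) (seq (im y) n))

  *ᶜ-zeroʳ : ∀ x → x *ℂ 0ℂ ≃ᶜ 0ℂ
  *ᶜ-zeroʳ x = pointwise-≃ᶜ
    (λ n → solve 2 (λ a b → proj₁ ((a , b) ⊠ (con 0ℚ , con 0ℚ)) := con 0ℚ) refl (seq (re x) n) (seq (im x) n))
    (λ n → solve 2 (λ a b → proj₂ ((a , b) ⊠ (con 0ℚ , con 0ℚ)) := con 0ℚ) refl (seq (re x) n) (seq (im x) n))

  *ᶜ-identityʳ : ∀ x → x *ℂ 1ℂ ≃ᶜ x
  *ᶜ-identityʳ x = pointwise-≃ᶜ
    (λ n → solve 2 (λ a b → proj₁ ((a , b) ⊠ (con 1ℚ , con 0ℚ)) := a) refl (seq (re x) n) (seq (im x) n))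
    (λ n → solve 2 (λ a b → proj₂ ((a , b) ⊠ (con 1ℚ , con 0ℚ)) := b) refl (seq (re x) n) (seq (im x) n))

  conj-+ : ∀ x y → conj (x +ℂ y) ≃ᶜ conj x +ℂ conj y
  conj-+ x y = pointwise-≃ᶜ (λ _ → refl)
    (λ n → solve 2 (λ b d → :- (b :+ d) := :- b :+ :- d) refl (seq (im x) n) (seq (im y) n))

  -- Separates the amplitudes `v`, `v′` from the matrix entries `u`, `u′`; a sum over rows then acts
  -- on the entries alone and meets `U†U≈I`.
  conj*-rearrange : ∀ u v u′ v′ → conj (u *ℂ v) *ℂ (u′ *ℂ v′) ≃ᶜ (conj v *ℂ v′) *ℂ (conj u *ℂ u′)
  conj*-rearrange u v u′ v′ = pointwise-≃ᶜ
    (λ n → solve 8 (λ a b c d e f g h →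
        proj₁ (bar ((a , b) ⊠ (c , d)) ⊠ ((e , f) ⊠ (g , h))) := proj₁ ((bar (c , d) ⊠ (g , h)) ⊠ (bar (a , b) ⊠ (e , f)))) refl
      (seq (re u) n) (seq (im u) n) (seq (re v) n) (seq (im v) n)
      (seq (re u′) n) (seq (im u′) n) (seq (re v′) n) (seq (im v′) n))
    (λ n → solve 8 (λ a b c d e f g h →
        proj₂ (bar ((a , b) ⊠ (c , d)) ⊠ ((e , f) ⊠ (g , h))) := proj₂ ((bar (c , d) ⊠ (g , h)) ⊠ (bar (a , b) ⊠ (e , f)))) refl
      (seq (re u) n) (seq (im u) n) (seq (re v) n) (seq (im v) n)
      (seq (re u′) n) (seq (im u′) n) (seq (re v′) n) (seq (im v′) n))

  re-conj*≃∣∣² : ∀ z → re (conj z *ℂ z) ≃ ∣ z ∣²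
  re-conj*≃∣∣² z = pointwise-≃ λ n →
    solve 2 (λ a b → proj₁ (bar (a , b) ⊠ (a , b)) := a :* a :+ b :* b) refl (seq (re z) n) (seq (im z) n)

  *ᶜ-distribˡ-- : ∀ x y z → x *ℂ (y -ℂ z) ≃ᶜ x *ℂ y -ℂ x *ℂ z
  *ᶜ-distribˡ-- x y z = pointwise-≃ᶜ
    (λ n → solve 6 (λ a b c d e f → proj₁ ((a , b) ⊠ ((c , d) ⊟ (e , f))) := proj₁ (((a , b) ⊠ (c , d)) ⊟ ((a , b) ⊠ (e , f)))) refl
      (seq (re x) n) (seq (im x) n) (seq (re y) n) (seq (im y) n) (seq (re z) n) (seq (im z) n))
    (λ n → solve 6 (λ a b c d e f → proj₂ ((a , b) ⊠ ((c , d) ⊟ (e , f))) := proj₂ (((a , b) ⊠ (c , d)) ⊟ ((a , b) ⊠ (e , f)))) refl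
      (seq (re x) n) (seq (im x) n) (seq (re y) n) (seq (im y) n) (seq (re z) n) (seq (im z) n))

  -ᶜ-interchange : ∀ a b c d → (a +ℂ b) -ℂ (c +ℂ d) ≃ᶜ (a -ℂ c) +ℂ (b -ℂ d)
  -ᶜ-interchange a b c d = pointwise-≃ᶜ
    (λ n → ℚ-Identities.plus-minus (seq (re a) n) (seq (re b) n) (seq (re c) n) (seq (re d) n))
    (λ n → ℚ-Identities.plus-minus (seq (im a) n) (seq (im b) n) (seq (im c) n) (seq (im d) n))

open Identities

module Σℝ = Sums ℝ-+-commutativeMonoid
module Σℂ = Sums ℂ-+-commutativeMonoid

conj-∑ : ∀ {N W} (g : Basis N W → ℂ) → conj (∑ℂ g) ≃ᶜ ∑ℂ (conj ∘ g)
conj-∑ g = Σℂ.Additive.∑ᴮ-additive {A = ⊤} (λ f → conj (f tt))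
  (pointwise-≃ᶜ (λ _ → refl) (λ _ → refl)) (λ f h → conj-+ (f tt) (h tt)) (λ a _ → g a)

∑-*ᶜ : ∀ {N W} (g : Basis N W → ℂ) z → ∑ℂ g *ℂ z ≃ᶜ ∑ℂ (λ a → g a *ℂ z)
∑-*ᶜ g z = Σℂ.Additive.∑ᴮ-additive {A = ⊤} (λ f → f tt *ℂ z)
  (≃ᶜ-trans (*ᶜ-comm 0ℂ z) (*ᶜ-zeroʳ z)) (λ f h → *ᶜ-distribʳ-+ (f tt) (h tt) z) (λ a _ → g a)

*ᶜ-∑ : ∀ {N W} z (g : Basis N W → ℂ) → z *ℂ ∑ℂ g ≃ᶜ ∑ℂ (λ a → z *ℂ g a)
*ᶜ-∑ z g = ≃ᶜ-trans (*ᶜ-comm z (∑ℂ g))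
  (≃ᶜ-trans (∑-*ᶜ g z) (Σℂ.∑ᴮ-cong λ a → *ᶜ-comm (g a) z))

∑-- : ∀ {N W} (f g : Basis N W → ℂ) → ∑ℂ f -ℂ ∑ℂ g ≃ᶜ ∑ℂ (λ a → f a -ℂ g a)
∑-- f g = Σℂ.Additive.∑ᴮ-additive {A = Bool} (λ p → p false -ℂ p true)
  (pointwise-≃ᶜ (λ _ → refl) (λ _ → refl))
  (λ p q → -ᶜ-interchange (p false) (q false) (p true) (q true))
  (λ a t → if t then g a else f a)

re-∑ : ∀ {N W} (g : Basis N W → ℂ) → re (∑ℂ g) ≃ ∑ℝ (re ∘ g)
re-∑ g = Σℝ.Additive.∑ᴮ-additive {A = ⊤} (λ f → re (f tt)) ≃-refl (λ _ _ → ≃-refl) (λ a _ → g a)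

-- The norm

norm² : ∀ {N W} → State N W → ℝ
norm² ψ = ∑ℝ λ a → ∣ ψ a ∣²

inner : ∀ {N W} → State N W → State N W → ℂ
inner φ ψ = ∑ℂ λ a → conj (φ a) *ℂ ψ a

-- Unitarity is an identity between complex sums, so preservation of `norm²` is proved for `inner`
-- and transferred through the real part.
norm²≃inner : ∀ {N W} (ψ : State N W) → re (inner ψ ψ) ≃ norm² ψ
norm²≃inner ψ = ≃-trans (re-∑ λ a → conj (ψ a) *ℂ ψ a) (Σℝ.∑ᴮ-cong λ a → re-conj*≃∣∣² (ψ a))

ket-≢ : ∀ {N W} {a b : Basis N W} → a ≢ b → ket a b ≡ 0ℂ
ket-≢ {a = a} {b} a≢b with a ≟ᴮ b
... | yes a≡b = contradiction a≡b a≢b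
... | no  _   = refl

ket-refl : ∀ {N W} (a : Basis N W) → ket a a ≡ 1ℂ
ket-refl a with a ≟ᴮ a
... | yes _   = refl
... | no  a≢a = contradiction refl a≢a

≡⇒≃ᶜ : ∀ {z w} → z ≡ w → z ≃ᶜ w
≡⇒≃ᶜ refl = ≃ᶜ-refl

∑-ket : ∀ {N W} (b : Basis N W) (g : Basis N W → ℂ) → ∑ℂ (λ c → g c *ℂ ket b c) ≃ᶜ g b
∑-ket b g = ≃ᶜ-trans
  (Σℂ.∑ᴮ-single b λ c c≢b → ≃ᶜ-trans (*ᶜ-cong ≃ᶜ-refl (≡⇒≃ᶜ (ket-≢ (c≢b ∘ sym)))) (*ᶜ-zeroʳ (g c)))
  (≃ᶜ-trans (*ᶜ-cong ≃ᶜ-refl (≡⇒≃ᶜ (ket-refl b))) (*ᶜ-identityʳ (g b)))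

-- The triple sum is reordered until the row index `a` is innermost. There the orthonormality of the
-- columns of `U` leaves `ket b c`, which collapses the sum over `c`.
inner-apply : ∀ {N W} (U : Unitary N W) (ψ : State N W) → inner (apply U ψ) (apply U ψ) ≃ᶜ inner ψ ψ
inner-apply U ψ = begin
  ∑ℂ (λ a → conj (apply U ψ a) *ℂ apply U ψ a)
    ≈⟨ Σℂ.∑ᴮ-cong expand ⟩
  ∑ℂ (λ a → ∑ℂ (λ b → ∑ℂ (λ c → term a b c)))
    ≈⟨ Σℂ.∑ᴮ-swap (λ a b → ∑ℂ (λ c → term a b c)) ⟩
  ∑ℂ (λ b → ∑ℂ (λ a → ∑ℂ (λ c → term a b c)))
    ≈⟨ Σℂ.∑ᴮ-cong (λ b → Σℂ.∑ᴮ-swap (λ a c → term a b c)) ⟩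
  ∑ℂ (λ b → ∑ℂ (λ c → ∑ℂ (λ a → term a b c)))
    ≈⟨ Σℂ.∑ᴮ-cong (λ b → Σℂ.∑ᴮ-cong (λ c → orthonormal b c)) ⟩
  ∑ℂ (λ b → ∑ℂ (λ c → (conj (ψ b) *ℂ ψ c) *ℂ ket b c))
    ≈⟨ Σℂ.∑ᴮ-cong (λ b → ∑-ket b (λ c → conj (ψ b) *ℂ ψ c)) ⟩
  inner ψ ψ ∎
  where
  open ≈-Reasoning (CommutativeMonoid.setoid ℂ-+-commutativeMonoid)

  term : _ → _ → _ → ℂ
  term a b c = conj (entry U a b *ℂ ψ b) *ℂ (entry U a c *ℂ ψ c)

  expand : ∀ a → conj (apply U ψ a) *ℂ apply U ψ a ≃ᶜ ∑ℂ (λ b → ∑ℂ (λ c → term a b c))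
  expand a = begin
    conj (apply U ψ a) *ℂ apply U ψ a
      ≈⟨ *ᶜ-cong (conj-∑ (λ b → entry U a b *ℂ ψ b)) ≃ᶜ-refl ⟩
    ∑ℂ (λ b → conj (entry U a b *ℂ ψ b)) *ℂ apply U ψ a
      ≈⟨ ∑-*ᶜ (λ b → conj (entry U a b *ℂ ψ b)) (apply U ψ a) ⟩
    ∑ℂ (λ b → conj (entry U a b *ℂ ψ b) *ℂ apply U ψ a)
      ≈⟨ Σℂ.∑ᴮ-cong (λ b → *ᶜ-∑ (conj (entry U a b *ℂ ψ b)) (λ c → entry U a c *ℂ ψ c)) ⟩
    ∑ℂ (λ b → ∑ℂ (λ c → term a b c)) ∎

  orthonormal : ∀ b c → ∑ℂ (λ a → term a b c) ≃ᶜ (conj (ψ b) *ℂ ψ c) *ℂ ket b c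
  orthonormal b c = begin
    ∑ℂ (λ a → term a b c)
      ≈⟨ Σℂ.∑ᴮ-cong (λ a → conj*-rearrange (entry U a b) (ψ b) (entry U a c) (ψ c)) ⟩
    ∑ℂ (λ a → (conj (ψ b) *ℂ ψ c) *ℂ (conj (entry U a b) *ℂ entry U a c))
      ≈⟨ *ᶜ-∑ (conj (ψ b) *ℂ ψ c) (λ a → conj (entry U a b) *ℂ entry U a c) ⟨
    (conj (ψ b) *ℂ ψ c) *ℂ ∑ℂ (λ a → conj (entry U a b) *ℂ entry U a c)
      ≈⟨ *ᶜ-cong ≃ᶜ-refl (wrap≃ᶜ (wrap≃ (proj₁ (U†U≈I U b c))) (wrap≃ (proj₂ (U†U≈I U b c)))) ⟩
    (conj (ψ b) *ℂ ψ c) *ℂ ket b c ∎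

norm²-apply : ∀ {N W} (U : Unitary N W) (ψ : State N W) → norm² (apply U ψ) ≃ norm² ψ
norm²-apply U ψ = ≃-trans (≃-sym (norm²≃inner (apply U ψ)))
  (≃-trans (re-≃ (inner-apply U ψ)) (norm²≃inner ψ))

norm²-ket : ∀ {N W} (a : Basis N W) → norm² (ket a) ≃ 1ℝ
norm²-ket a = ≃-trans
  (Σℝ.∑ᴮ-single a λ b b≢a → ≃-trans (∣∣²-cong (≡⇒≃ᶜ (ket-≢ (b≢a ∘ sym)))) (pointwise-≃ λ _ → refl))
  (≃-trans (∣∣²-cong (≡⇒≃ᶜ (ket-refl a))) (pointwise-≃ λ _ → refl))

-- Distances between states

infix 8 _²

_² : ℚ → ℚ
q ² = q * q

²-nonNeg : ∀ q → 0ℚ ≤ q ²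
²-nonNeg q with ℚ.≤-total 0ℚ q
... | inj₁ 0≤q = ℚ.≤-trans (ℚ.≤-reflexive (sym (ℚ.*-zeroʳ q))) (ℚ.*-monoˡ-≤-nonNeg q {{nonNegative 0≤q}} 0≤q)
... | inj₂ q≤0 = ℚ.≤-trans (ℚ.≤-reflexive (sym (ℚ.*-zeroʳ q))) (ℚ.*-monoˡ-≤-nonPos q {{nonPositive q≤0}} q≤0)

-- Each inequality of `SquareInequalities` is certified by writing the difference of its two sides
-- as a sum of two squares, one from the real and one from the imaginary part.
≤-from-squares : ∀ {p q} a b → q ≡ p + (a ² + b ²) → p ≤ q
≤-from-squares {p} a b refl = ℚ.≤-trans
  (ℚ.≤-reflexive (sym (ℚ.+-identityʳ p)))
  (ℚ.+-monoʳ-≤ p (ℚ.+-mono-≤ (²-nonNeg a) (²-nonNeg b)))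

2ℚ 3ℚ 4ℚ 6ℚ 18ℚ : ℚ
2ℚ = ℤ.+ 2 / 1
3ℚ = ℤ.+ 3 / 1
4ℚ = ℤ.+ 4 / 1
6ℚ = ℤ.+ 6 / 1
18ℚ = ℤ.+ 18 / 1

module SquareInequalities where
  open +-*-Solver

  -- With a = v - w and b = u - v as complex numbers, the difference of the two sides is the squared
  -- modulus of a - k b.
  triangle : ∀ k u v w u′ v′ w′ →
    k * ((u - w) ² + (u′ - w′) ²) ≤
    (1ℚ + k) * ((v - w) ² + (v′ - w′) ²) + (k * (1ℚ + k)) * ((u - v) ² + (u′ - v′) ²)
  triangle k u v w u′ v′ w′ = ≤-from-squares ((v - w) - k * (u - v)) ((v′ - w′) - k * (u′ - v′))
    (solve 7 (λ k u v w u′ v′ w′ →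
      (con 1ℚ :+ k) :* ((v :- w) :* (v :- w) :+ (v′ :- w′) :* (v′ :- w′))
        :+ (k :* (con 1ℚ :+ k)) :* ((u :- v) :* (u :- v) :+ (u′ :- v′) :* (u′ :- v′))
      := k :* ((u :- w) :* (u :- w) :+ (u′ :- w′) :* (u′ :- w′))
        :+ (((v :- w) :- k :* (u :- v)) :* ((v :- w) :- k :* (u :- v))
          :+ ((v′ :- w′) :- k :* (u′ :- v′)) :* ((v′ :- w′) :- k :* (u′ :- v′))))
      refl k u v w u′ v′ w′)

  parallelogram : ∀ a b c d →
    (a - c) ² + (b - d) ² ≤ 2ℚ * (a ² + b ²) + 2ℚ * (c ² + d ²)
  parallelogram a b c d = ≤-from-squares (a + c) (b + d)
    (solve 4 (λ a b c d →
      con 2ℚ :* (a :* a :+ b :* b) :+ con 2ℚ :* (c :* c :+ d :* d)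
      := ((a :- c) :* (a :- c) :+ (b :- d) :* (b :- d)) :+ ((a :+ c) :* (a :+ c) :+ (b :+ d) :* (b :+ d)))
      refl a b c d)

  -- This is `triangle` with `k = 2` and `w = 0`. The summand `3ℚ * 0ℚ` keeps the left side in the
  -- form in which it arises in `measurement-bound`.
  measured-first : ∀ a b c d →
    2ℚ * (a ² + b ²) + 3ℚ * 0ℚ ≤ 3ℚ * (c ² + d ²) + 6ℚ * ((a - c) ² + (b - d) ²)
  measured-first a b c d = ≤-from-squares (3ℚ * c - 2ℚ * a) (3ℚ * d - 2ℚ * b)
    (solve 4 (λ a b c d →
      con 3ℚ :* (c :* c :+ d :* d) :+ con 6ℚ :* ((a :- c) :* (a :- c) :+ (b :- d) :* (b :- d))
      := (con 2ℚ :* (a :* a :+ b :* b) :+ con 3ℚ :* con 0ℚ)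
        :+ ((con 3ℚ :* c :- con 2ℚ :* a) :* (con 3ℚ :* c :- con 2ℚ :* a)
          :+ (con 3ℚ :* d :- con 2ℚ :* b) :* (con 3ℚ :* d :- con 2ℚ :* b)))
      refl a b c d)

∣-∣²-triangle : ∀ k u v w → k · ∣ u -ℂ w ∣² ≲ (1ℚ + k) · ∣ v -ℂ w ∣² +ℝ (k * (1ℚ + k)) · ∣ u -ℂ v ∣²
∣-∣²-triangle k u v w = pointwise-≲ λ n → SquareInequalities.triangle k
  (seq (re u) n) (seq (re v) n) (seq (re w) n) (seq (im u) n) (seq (im v) n) (seq (im w) n)

∣-∣²-parallelogram : ∀ z w → ∣ z -ℂ w ∣² ≲ 2ℚ · ∣ z ∣² +ℝ 2ℚ · ∣ w ∣²
∣-∣²-parallelogram z w = pointwise-≲ λ n → SquareInequalities.parallelogram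
  (seq (re z) n) (seq (im z) n) (seq (re w) n) (seq (im w) n)

∣∣²-nonNeg : ∀ z → 0ℝ ≲ ∣ z ∣²
∣∣²-nonNeg z = pointwise-≲ λ n → ℚ.+-mono-≤ (²-nonNeg (seq (re z) n)) (²-nonNeg (seq (im z) n))

∣z-z∣²≃0 : ∀ z → ∣ z -ℂ z ∣² ≃ 0ℝ
∣z-z∣²≃0 z = pointwise-≃ λ n → cong₂ (λ p q → p ² + q ²) (ℚ.+-inverseʳ (seq (re z) n)) (ℚ.+-inverseʳ (seq (im z) n))

·-distribˡ-+ : ∀ q x y → q · (x +ℝ y) ≃ q · x +ℝ q · y
·-distribˡ-+ q x y = pointwise-≃ λ n → ℚ.*-distribˡ-+ q (seq x n) (seq y n)

·-zeroʳ : ∀ q → q · 0ℝ ≃ 0ℝ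
·-zeroʳ q = pointwise-≃ λ _ → ℚ.*-zeroʳ q

·-cong : ∀ q {x y} → x ≃ y → q · x ≃ q · y
·-cong q = *-cong ≃-refl

private
  module Scale (q : ℚ) = Σℝ.Additive {A = ⊤} {_⊕_ = _+ℝ_} {e = 0ℝ} (λ f → q · f tt)
    (·-zeroʳ q) (λ f g → ·-distribˡ-+ q (f tt) (g tt))

·-∑ᶠ : ∀ q {n} (f : Fin n → ℝ) → q · Σℝ.∑ᶠ f ≃ Σℝ.∑ᶠ (λ i → q · f i)
·-∑ᶠ q f = Scale.∑ᶠ-additive q (λ i _ → f i)

·-∑ᴮ : ∀ q {N W} (f : Basis N W → ℝ) → q · ∑ℝ f ≃ ∑ℝ (λ a → q · f a)
·-∑ᴮ q f = Scale.∑ᴮ-additive q (λ a _ → f a)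

∑ᶠ-linear : ∀ p q {n} (f g : Fin n → ℝ) → Σℝ.∑ᶠ (λ i → p · f i +ℝ q · g i) ≃ p · Σℝ.∑ᶠ f +ℝ q · Σℝ.∑ᶠ g
∑ᶠ-linear p q f g = ≃-sym (≃-trans (+-cong (·-∑ᶠ p f) (·-∑ᶠ q g)) (Σℝ.∑ᶠ-∙ (λ i → p · f i) (λ i → q · g i)))

∑ᴮ-linear : ∀ p q {N W} (f g : Basis N W → ℝ) → ∑ℝ (λ a → p · f a +ℝ q · g a) ≃ p · ∑ℝ f +ℝ q · ∑ℝ g
∑ᴮ-linear p q f g = ≃-sym (≃-trans (+-cong (·-∑ᴮ p f) (·-∑ᴮ q g)) (Σℝ.∑ᴮ-∙ (λ a → p · f a) (λ a → q · g a)))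

∑ᶠ-mono : ∀ {n} {f g : Fin n → ℝ} → (∀ i → f i ≲ g i) → Σℝ.∑ᶠ f ≲ Σℝ.∑ᶠ g
∑ᶠ-mono = foldr-preserves _≲_ ≲-refl +-mono

∑ᴮ-mono : ∀ {N W} {f g : Basis N W → ℝ} → (∀ a → f a ≲ g a) → ∑ℝ f ≲ ∑ℝ g
∑ᴮ-mono = sumOver-preserves _≲_ ≲-refl +-mono

dist² : ∀ {N W} → State N W → State N W → ℝ
dist² ψ φ = norm² (λ a → ψ a -ℂ φ a)

dist²-apply : ∀ {N W} (U : Unitary N W) (ψ φ : State N W) → dist² (apply U ψ) (apply U φ) ≃ dist² ψ φ
dist²-apply U ψ φ = ≃-trans
  (Σℝ.∑ᴮ-cong λ a → ∣∣²-cong (≃ᶜ-trans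
    (∑-- (λ b → entry U a b *ℂ ψ b) (λ b → entry U a b *ℂ φ b))
    (Σℂ.∑ᴮ-cong λ b → ≃ᶜ-sym (*ᶜ-distribˡ-- (entry U a b) (ψ b) (φ b)))))
  (norm²-apply U (λ a → ψ a -ℂ φ a))

dist²-nonNeg : ∀ {N W} (ψ φ : State N W) → 0ℝ ≲ dist² ψ φ
dist²-nonNeg {N} {W} ψ φ = ≲-trans (≃⇒≲ (≃-sym (Σℝ.∑ᴮ-zero {N} {W} λ _ → ≃-refl)))
  (∑ᴮ-mono λ a → ∣∣²-nonNeg (ψ a -ℂ φ a))

dist²-self : ∀ {N W} (ψ : State N W) → dist² ψ ψ ≃ 0ℝ
dist²-self ψ = Σℝ.∑ᴮ-zero λ a → ∣z-z∣²≃0 (ψ a)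

dist²-triangle : ∀ k {N W} (u v w : State N W) →
  k · dist² u w ≲ (1ℚ + k) · dist² v w +ℝ (k * (1ℚ + k)) · dist² u v
dist²-triangle k u v w = begin
  k · dist² u w
    ≈⟨ ·-∑ᴮ k (λ a → ∣ u a -ℂ w a ∣²) ⟩
  ∑ℝ (λ a → k · ∣ u a -ℂ w a ∣²)
    ≲⟨ ∑ᴮ-mono (λ a → ∣-∣²-triangle k (u a) (v a) (w a)) ⟩
  ∑ℝ (λ a → (1ℚ + k) · ∣ v a -ℂ w a ∣² +ℝ (k * (1ℚ + k)) · ∣ u a -ℂ v a ∣²)
    ≈⟨ ∑ᴮ-linear (1ℚ + k) (k * (1ℚ + k)) (λ a → ∣ v a -ℂ w a ∣²) (λ a → ∣ u a -ℂ v a ∣²) ⟩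
  (1ℚ + k) · dist² v w +ℝ (k * (1ℚ + k)) · dist² u v ∎
  where open ≲-Reasoning ≲-preorder

-- Queries

-- For each query index the oracle either fixes or exchanges the blocks with answer bit `false` and
-- `true`.
∑-xor : ∀ {N W} (x : Input N) (g : Basis N W → ℝ) → ∑ℝ (λ (i , b , w) → g (i , b xor x i , w)) ≃ ∑ℝ g
∑-xor x g = Σℝ.∑ᶠ-cong λ i → block (x i) (λ b → Σℝ.∑ᶠ (λ w → g (i , b , w)))
  where
  block : ∀ c (h : Bool → ℝ) → h (false xor c) +ℝ h (true xor c) ≃ h false +ℝ h true
  block false h = ≃-refl
  block true  h = CommutativeMonoid.comm ℝ-+-commutativeMonoid (h true) (h false)

norm²-query : ∀ {N W} (x : Input N) (ψ : State N W) → norm² (query x ψ) ≃ norm² ψ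
norm²-query x ψ = ∑-xor x (λ a → ∣ ψ a ∣²)

dist²-query : ∀ {N W} (x : Input N) (ψ φ : State N W) → dist² (query x ψ) (query x φ) ≃ dist² ψ φ
dist²-query x ψ φ = ∑-xor x (λ a → ∣ ψ a -ℂ φ a ∣²)

flip : ∀ {N} → Input N → Fin N → Input N
flip x i = updateAt x i not

-- The query magnitude of `i`. It follows the shape of `sumOver`, so that its sum over all `i` is
-- `norm² ψ` by definition.
queryWeight : ∀ {N W} → State N W → Fin N → ℝ
queryWeight ψ i = Σℝ.∑ᶠ (λ w → ∣ ψ (i , false , w) ∣²) +ℝ Σℝ.∑ᶠ (λ w → ∣ ψ (i , true , w) ∣²)

-- The two oracles differ only at index `i`, where exactly one of them exchanges the answer blocks.
-- By the parallelogram inequality each of the two blocks contributes at most twice the query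
-- weight.
dist²-query-flip : ∀ {N W} (x : Input N) (ψ : State N W) i →
  dist² (query x ψ) (query (flip x i) ψ) ≲ 4ℚ · queryWeight ψ i
dist²-query-flip x ψ i = ≲-trans
  (≃⇒≲ (Σℝ.∑ᶠ-single i λ j j≢i → ≃-trans
    (+-cong (Σℝ.∑ᶠ-zero λ w → unchanged j j≢i false w) (Σℝ.∑ᶠ-zero λ w → unchanged j j≢i true w))
    (pointwise-≃ λ _ → refl)))
  (changed (x i) (flip x i i) (updateAt-updates i x))
  where
  unchanged : ∀ j → j ≢ i → ∀ b w → ∣ ψ (j , b xor x j , w) -ℂ ψ (j , b xor flip x i j , w) ∣² ≃ 0ℝ
  unchanged j j≢i b w rewrite updateAt-minimal j i {not} x j≢i = ∣z-z∣²≃0 (ψ (j , b xor x j , w))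

  both : ∀ b c → Σℝ.∑ᶠ (λ w → ∣ ψ (i , b , w) -ℂ ψ (i , c , w) ∣²) ≲
    2ℚ · Σℝ.∑ᶠ (λ w → ∣ ψ (i , b , w) ∣²) +ℝ 2ℚ · Σℝ.∑ᶠ (λ w → ∣ ψ (i , c , w) ∣²)
  both b c = ≲-trans (∑ᶠ-mono λ w → ∣-∣²-parallelogram (ψ (i , b , w)) (ψ (i , c , w)))
    (≃⇒≲ (∑ᶠ-linear 2ℚ 2ℚ (λ w → ∣ ψ (i , b , w) ∣²) (λ w → ∣ ψ (i , c , w) ∣²)))

  collect : ∀ p q → (2ℚ * p + 2ℚ * q) + (2ℚ * q + 2ℚ * p) ≡ 4ℚ * (p + q)
  collect = solve 2 (λ p q → (con 2ℚ :* p :+ con 2ℚ :* q) :+ (con 2ℚ :* q :+ con 2ℚ :* p) := con 4ℚ :* (p :+ q)) refl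
    where open +-*-Solver

  collect′ : ∀ p q → (2ℚ * q + 2ℚ * p) + (2ℚ * p + 2ℚ * q) ≡ 4ℚ * (p + q)
  collect′ p q = trans (ℚ.+-comm (2ℚ * q + 2ℚ * p) (2ℚ * p + 2ℚ * q)) (collect p q)

  m : Bool → ℝ
  m b = Σℝ.∑ᶠ (λ w → ∣ ψ (i , b , w) ∣²)

  changed : ∀ b c → c ≡ not b →
    Σℝ.∑ᶠ (λ w → ∣ ψ (i , false xor b , w) -ℂ ψ (i , false xor c , w) ∣²) +ℝ
    Σℝ.∑ᶠ (λ w → ∣ ψ (i , true xor b , w) -ℂ ψ (i , true xor c , w) ∣²) ≲ 4ℚ · queryWeight ψ i
  changed false _ refl = ≲-trans (+-mono (both false true) (both true false))
    (≃⇒≲ (pointwise-≃ λ n → collect (seq (m false) n) (seq (m true) n)))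
  changed true _ refl = ≲-trans (+-mono (both true false) (both false true))
    (≃⇒≲ (pointwise-≃ λ n → collect′ (seq (m false) n) (seq (m true) n)))

∑-dist²-query-flip : ∀ {N W} (x : Input N) (ψ : State N W) →
  Σℝ.∑ᶠ (λ i → dist² (query x ψ) (query (flip x i) ψ)) ≲ 4ℚ · norm² ψ
∑-dist²-query-flip x ψ = ≲-trans (∑ᶠ-mono (dist²-query-flip x ψ)) (≃⇒≲ (≃-sym (·-∑ᶠ 4ℚ (queryWeight ψ))))

-- Natural numbers as rationals

ι : ℕ → ℚ
ι n = ℤ.+ n / 1

-- The normalisation in `_/_` is stuck on a variable numerator, so the laws of `ι` are transported
-- from unnormalised rationals, where they reduce to facts about integers.
toℚᵘ-ι : ∀ n → toℚᵘ (ι n) ℚᵘ.≃ mkℚᵘ (ℤ.+ n) 0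
toℚᵘ-ι n = ℚ.toℚᵘ-fromℚᵘ (mkℚᵘ (ℤ.+ n) 0)

ι-+ : ∀ m n → ι (m ℕ.+ n) ≡ ι m + ι n
ι-+ m n = ℚ.toℚᵘ-injective (begin
  toℚᵘ (ι (m ℕ.+ n))                      ≈⟨ toℚᵘ-ι (m ℕ.+ n) ⟩
  mkℚᵘ (ℤ.+ (m ℕ.+ n)) 0                  ≈⟨ *≡* (cong (ℤ._* ℤ.1ℤ) (cong₂ ℤ._+_ (sym (ℤ.*-identityʳ (ℤ.+ m))) (sym (ℤ.*-identityʳ (ℤ.+ n))))) ⟩
  mkℚᵘ (ℤ.+ m) 0 ℚᵘ.+ mkℚᵘ (ℤ.+ n) 0      ≈⟨ ℚᵘ.+-cong (toℚᵘ-ι m) (toℚᵘ-ι n) ⟨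
  toℚᵘ (ι m) ℚᵘ.+ toℚᵘ (ι n)              ≈⟨ ℚ.toℚᵘ-homo-+ (ι m) (ι n) ⟨
  toℚᵘ (ι m + ι n)                        ∎)
  where open ≈-Reasoning ℚᵘ.≃-setoid

ι-* : ∀ m n → ι (m ℕ.* n) ≡ ι m * ι n
ι-* m n = ℚ.toℚᵘ-injective (begin
  toℚᵘ (ι (m ℕ.* n))                      ≈⟨ toℚᵘ-ι (m ℕ.* n) ⟩
  mkℚᵘ (ℤ.+ (m ℕ.* n)) 0                  ≈⟨ *≡* (cong (ℤ._* ℤ.1ℤ) (ℤ.pos-* m n)) ⟩
  mkℚᵘ (ℤ.+ m) 0 ℚᵘ.* mkℚᵘ (ℤ.+ n) 0      ≈⟨ ℚᵘ.*-cong (toℚᵘ-ι m) (toℚᵘ-ι n) ⟨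
  toℚᵘ (ι m) ℚᵘ.* toℚᵘ (ι n)              ≈⟨ ℚ.toℚᵘ-homo-* (ι m) (ι n) ⟨
  toℚᵘ (ι m * ι n)                        ∎)
  where open ≈-Reasoning ℚᵘ.≃-setoid

ι-mono-≤ : ∀ {m n} → m ℕ.≤ n → ι m ≤ ι n
ι-mono-≤ {m} {n} m≤n = ℚ.toℚᵘ-cancel-≤ (begin
  toℚᵘ (ι m)      ≃⟨ toℚᵘ-ι m ⟩
  mkℚᵘ (ℤ.+ m) 0  ≤⟨ *≤* (ℤ.*-monoʳ-≤-nonNeg ℤ.1ℤ (ℤ.+≤+ m≤n)) ⟩
  mkℚᵘ (ℤ.+ n) 0  ≃⟨ toℚᵘ-ι n ⟨
  toℚᵘ (ι n)      ∎)
  where open ℚᵘ.≤-Reasoning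

ι-cancel-≤ : ∀ {m n} → ι m ≤ ι n → m ℕ.≤ n
ι-cancel-≤ {m} {n} m≤n = ℤ.drop‿+≤+ (ℤ.*-cancelʳ-≤-pos (ℤ.+ m) (ℤ.+ n) ℤ.1ℤ (ℚᵘ.drop-*≤* (begin
  mkℚᵘ (ℤ.+ m) 0  ≃⟨ toℚᵘ-ι m ⟨
  toℚᵘ (ι m)      ≤⟨ ℚ.toℚᵘ-mono-≤ m≤n ⟩
  toℚᵘ (ι n)      ≃⟨ toℚᵘ-ι n ⟩
  mkℚᵘ (ℤ.+ n) 0  ∎)))
  where open ℚᵘ.≤-Reasoning

ι-suc>0 : ∀ n → 0ℚ < ι (suc n)
ι-suc>0 n = ℚ.<-≤-trans (ℚ.positive⁻¹ 1ℚ) (ι-mono-≤ {1} {suc n} (ℕ.s≤s ℕ.z≤n))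

-- The hybrid argument

module Hybrid {N W : ℕ} (x : Input N) where

  run : ∀ {t} → Input N → State N W → Vec (Unitary N W) t → State N W
  run y = Vec.foldl (λ _ → State N W) (λ ψ U → apply U (query y ψ))

  totalDist² : State N W → (Fin N → State N W) → ℝ
  totalDist² ψ φ = Σℝ.∑ᶠ (λ i → dist² ψ (φ i))

  bound : ℕ → ℚ
  bound s = 4ℚ * (ι s * ι (suc s))

  -- With `k = s + 1` both sides equal 4 (s + 1)² (s + 2), so the triangle inequality turns
  -- `bound s` into `bound (suc s)` without slack. The factor `4ℚ * 1ℚ` bounds the total new error
  -- on a unit state.
  bound-step : ∀ s → (1ℚ + ι (suc s)) * bound s + (ι (suc s) * (1ℚ + ι (suc s))) * (4ℚ * 1ℚ) ≡ ι (suc s) * bound (suc s)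
  bound-step s rewrite ι-+ 1 (suc s) | ι-+ 1 s = solve 1 (λ a →
    (con 1ℚ :+ (con 1ℚ :+ a)) :* (con 4ℚ :* (a :* (con 1ℚ :+ a))) :+ ((con 1ℚ :+ a) :* (con 1ℚ :+ (con 1ℚ :+ a))) :* (con 4ℚ :* con 1ℚ)
    := (con 1ℚ :+ a) :* (con 4ℚ :* ((con 1ℚ :+ a) :* (con 1ℚ :+ (con 1ℚ :+ a))))) refl (ι s)
    where open +-*-Solver

  totalDist²-step : ∀ s (U : Unitary N W) ψ φ → norm² ψ ≃ 1ℝ → totalDist² ψ φ ≲ fromℚ (bound s) →
    totalDist² (apply U (query x ψ)) (λ i → apply U (query (flip x i) (φ i))) ≲ fromℚ (bound (suc s))
  -- The inequality is proved after multiplication by `k`, which keeps the weights of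
  -- `dist²-triangle` free of fractions.
  totalDist²-step s U ψ φ ‖ψ‖≃1 le = ·-cancel k>0 (begin
    k · totalDist² (apply U (query x ψ)) (λ i → apply U (query (flip x i) (φ i)))
      ≈⟨ ·-cong k (Σℝ.∑ᶠ-cong λ i → dist²-apply U (query x ψ) (query (flip x i) (φ i))) ⟩
    k · Σℝ.∑ᶠ (λ i → dist² (query x ψ) (query (flip x i) (φ i)))
      ≈⟨ ·-∑ᶠ k (λ i → dist² (query x ψ) (query (flip x i) (φ i))) ⟩
    Σℝ.∑ᶠ (λ i → k · dist² (query x ψ) (query (flip x i) (φ i)))
      -- The intermediate state is the flipped oracle on the unperturbed `ψ`: it is at the old
      -- distance from `query (flip x i) (φ i)`, and its distance from `query x ψ` is the error of
      -- this query alone.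
      ≲⟨ ∑ᶠ-mono (λ i → dist²-triangle k (query x ψ) (query (flip x i) ψ) (query (flip x i) (φ i))) ⟩
    Σℝ.∑ᶠ (λ i → k⁺ · dist² (query (flip x i) ψ) (query (flip x i) (φ i)) +ℝ
                  (k * k⁺) · dist² (query x ψ) (query (flip x i) ψ))
      ≈⟨ ∑ᶠ-linear k⁺ (k * k⁺) (λ i → dist² (query (flip x i) ψ) (query (flip x i) (φ i)))
                               (λ i → dist² (query x ψ) (query (flip x i) ψ)) ⟩
    k⁺ · Σℝ.∑ᶠ (λ i → dist² (query (flip x i) ψ) (query (flip x i) (φ i))) +ℝ
    (k * k⁺) · Σℝ.∑ᶠ (λ i → dist² (query x ψ) (query (flip x i) ψ))
      ≲⟨ +-mono
           (·-mono k⁺>0 (≲-trans (≃⇒≲ (Σℝ.∑ᶠ-cong λ i → dist²-query (flip x i) ψ (φ i))) le))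
           (·-mono kk⁺>0 (≲-trans (∑-dist²-query-flip x ψ) (≃⇒≲ (·-cong 4ℚ ‖ψ‖≃1)))) ⟩
    k⁺ · fromℚ (bound s) +ℝ (k * k⁺) · (4ℚ · 1ℝ)
      ≈⟨ pointwise-≃ (λ _ → bound-step s) ⟩
    k · fromℚ (bound (suc s)) ∎)
    where
    open ≲-Reasoning ≲-preorder
    k k⁺ : ℚ
    k  = ι (suc s)
    k⁺ = 1ℚ + k
    k>0 : 0ℚ < k
    k>0 = ι-suc>0 s
    k⁺>0 : 0ℚ < k⁺
    k⁺>0 = ℚ.+-mono-< (ℚ.positive⁻¹ 1ℚ) k>0
    kk⁺>0 : 0ℚ < k * k⁺
    kk⁺>0 = ℚ.positive⁻¹ (k * k⁺) {{ℚ.pos*pos⇒pos k {{positive k>0}} k⁺ {{positive k⁺>0}}}}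

  norm²-run : ∀ {t} y (Us : Vec (Unitary N W) t) {ψ} → norm² ψ ≃ 1ℝ → norm² (run y ψ Us) ≃ 1ℝ
  norm²-run y []       h = h
  norm²-run y (U ∷ Us) {ψ} h = norm²-run y Us
    (≃-trans (norm²-apply U (query y ψ)) (≃-trans (norm²-query y ψ) h))

  -- Stated for arbitrary intermediate states after `s` queries, because `foldl` consumes the gates
  -- from the front.
  totalDist²-run : ∀ {t} s (Us : Vec (Unitary N W) t) ψ φ → norm² ψ ≃ 1ℝ → totalDist² ψ φ ≲ fromℚ (bound s) →
    totalDist² (run x ψ Us) (λ i → run (flip x i) (φ i) Us) ≲ fromℚ (bound (s ℕ.+ t))
  totalDist²-run s [] ψ φ h le = subst (λ r → totalDist² ψ φ ≲ fromℚ (bound r)) (sym (ℕ.+-identityʳ s)) le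
  totalDist²-run {suc t} s (U ∷ Us) ψ φ h le = subst
    (λ r → totalDist² (run x ψ (U ∷ Us)) (λ i → run (flip x i) (φ i) (U ∷ Us)) ≲ fromℚ (bound r))
    (sym (ℕ.+-suc s t))
    (totalDist²-run (suc s) Us (apply U (query x ψ)) (λ i → apply U (query (flip x i) (φ i)))
      (≃-trans (norm²-apply U (query x ψ)) (≃-trans (norm²-query x ψ) h))
      (totalDist²-step s U ψ φ h le))

-- Sensitivity

-- If the outcome is `r`, this is `measured-first`; if it is `not r`, the term in `v` already stands
-- on the right and the remaining one is nonnegative.
measurement-bound : ∀ o r u v →
  2ℚ · (if does (o Bool.≟ r) then ∣ u ∣² else 0ℝ) +ℝ 3ℚ · (if does (o Bool.≟ not r) then ∣ v ∣² else 0ℝ)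
  ≲ 3ℚ · ∣ v ∣² +ℝ 6ℚ · ∣ u -ℂ v ∣²
measurement-bound o r u v = go o r
  where
  agree : 2ℚ · ∣ u ∣² +ℝ 3ℚ · 0ℝ ≲ 3ℚ · ∣ v ∣² +ℝ 6ℚ · ∣ u -ℂ v ∣²
  agree = pointwise-≲ λ n → SquareInequalities.measured-first
    (seq (re u) n) (seq (im u) n) (seq (re v) n) (seq (im v) n)

  disagree : 2ℚ · 0ℝ +ℝ 3ℚ · ∣ v ∣² ≲ 3ℚ · ∣ v ∣² +ℝ 6ℚ · ∣ u -ℂ v ∣²
  disagree = ≲-trans (≃⇒≲ (CommutativeMonoid.comm ℝ-+-commutativeMonoid (2ℚ · 0ℝ) (3ℚ · ∣ v ∣²)))
    (+-mono ≲-refl (≲-trans (≃⇒≲ (pointwise-≃ λ _ → refl)) (·-mono {6ℚ} (ℚ.positive⁻¹ 6ℚ) (∣∣²-nonNeg (u -ℂ v)))))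

  go : ∀ o r →
    2ℚ · (if does (o Bool.≟ r) then ∣ u ∣² else 0ℝ) +ℝ 3ℚ · (if does (o Bool.≟ not r) then ∣ v ∣² else 0ℝ)
    ≲ 3ℚ · ∣ v ∣² +ℝ 6ℚ · ∣ u -ℂ v ∣²
  go false false = agree
  go false true  = disagree
  go true  false = disagree
  go true  true  = agree

sensitive : ∀ {N} → (Input N → Bool) → Input N → Fin N → ℕ
sensitive f x i = if does (f (flip x i) Bool.≟ f x) then 0 else 1

sensitivity : ∀ {N} → (Input N → Bool) → Input N → ℕ
sensitivity f x = foldr ℕ._+_ 0 (sensitive f x)

module _ {N t : ℕ} (A : Algorithm N t) (f : Input N → Bool) (computes : ComputesBoundedError A f) where

  norm²-finalState : ∀ y → norm² (finalState A y) ≃ 1ℝ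
  norm²-finalState y = Hybrid.norm²-run y y (Us A) (≃-trans (norm²-apply (U₀ A) (ket (start A))) (norm²-ket (start A)))

  -- The weights 2 and 3 turn the two success probabilities 2/3 into 10/3, while `measurement-bound`
  -- sums to at most 3 + 6 d. Hence 1/3 is at most 6 d.
  sensitive⇒far : ∀ x y → f y ≡ not (f x) → 1ℝ ≲ 18ℚ · dist² (finalState A x) (finalState A y)
  sensitive⇒far x y fy≡ = begin
    1ℝ
      ≈⟨ pointwise-≃ (λ _ → refl) ⟩
    3ℚ · fromℚ (ℤ.+ 1 / 3)
      ≲⟨ ·-mono {3ℚ} (ℚ.positive⁻¹ 3ℚ) (+-cancelˡ {3ℚ · 1ℝ} separated) ⟩
    3ℚ · (6ℚ · d)
      ≈⟨ pointwise-≃ (λ n → sym (ℚ.*-assoc 3ℚ 6ℚ (seq d n))) ⟩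
    18ℚ · d ∎
    where
    open ≲-Reasoning ≲-preorder
    d : ℝ
    d = dist² (finalState A x) (finalState A y)

    u v : Basis N (workspace A) → ℝ
    u a = if does (output A a Bool.≟ f x) then ∣ finalState A x a ∣² else 0ℝ
    v a = if does (output A a Bool.≟ not (f x)) then ∣ finalState A y a ∣² else 0ℝ

    separated : 3ℚ · 1ℝ +ℝ fromℚ (ℤ.+ 1 / 3) ≲ 3ℚ · 1ℝ +ℝ 6ℚ · d
    separated = begin
      3ℚ · 1ℝ +ℝ fromℚ (ℤ.+ 1 / 3)
        ≈⟨ pointwise-≃ (λ _ → refl) ⟩
      2ℚ · fromℚ (ℤ.+ 2 / 3) +ℝ 3ℚ · fromℚ (ℤ.+ 2 / 3)
        ≲⟨ +-mono (·-mono (ℚ.positive⁻¹ 2ℚ) (wrap≲ (computes x)))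
                  (·-mono (ℚ.positive⁻¹ 3ℚ) (subst (λ r → fromℚ (ℤ.+ 2 / 3) ≲ outputProb A y r) fy≡ (wrap≲ (computes y)))) ⟩
      2ℚ · ∑ℝ u +ℝ 3ℚ · ∑ℝ v
        ≈⟨ ∑ᴮ-linear 2ℚ 3ℚ u v ⟨
      ∑ℝ (λ a → 2ℚ · u a +ℝ 3ℚ · v a)
        ≲⟨ ∑ᴮ-mono (λ a → measurement-bound (output A a) (f x) (finalState A x a) (finalState A y a)) ⟩
      ∑ℝ (λ a → 3ℚ · ∣ finalState A y a ∣² +ℝ 6ℚ · ∣ finalState A x a -ℂ finalState A y a ∣²)
        ≈⟨ ∑ᴮ-linear 3ℚ 6ℚ (λ a → ∣ finalState A y a ∣²) (λ a → ∣ finalState A x a -ℂ finalState A y a ∣²) ⟩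
      3ℚ · norm² (finalState A y) +ℝ 6ℚ · d
        ≈⟨ +-cong (·-cong 3ℚ (norm²-finalState y)) ≃-refl ⟩
      3ℚ · 1ℝ +ℝ 6ℚ · d ∎

  sensitive≲dist² : ∀ x i → fromℚ (ι (sensitive f x i)) ≲ 18ℚ · dist² (finalState A x) (finalState A (flip x i))
  sensitive≲dist² x i = by-cases (f (flip x i) Bool.≟ f x)
    where
    by-cases : (d : Dec (f (flip x i) ≡ f x)) →
      fromℚ (ι (if does d then 0 else 1)) ≲ 18ℚ · dist² (finalState A x) (finalState A (flip x i))
    by-cases (yes _) = ≲-trans (≃⇒≲ (≃-sym (·-zeroʳ 18ℚ)))
      (·-mono (ℚ.positive⁻¹ 18ℚ) (dist²-nonNeg (finalState A x) (finalState A (flip x i))))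
    by-cases (no f≢) = sensitive⇒far x (flip x i) (Bool.¬-not f≢)

  -- Every sensitive bit uses at least 1/18 of a total squared distance of at most 4 t (t + 1), and
  -- 72 is 18 times 4.
  sensitivity-bound : ∀ x → sensitivity f x ℕ.≤ 72 ℕ.* (t ℕ.* suc t)
  sensitivity-bound x = ι-cancel-≤ (ℚ.≤-trans (fromℚ-reflects-≤ chain) (ℚ.≤-reflexive (sym expand)))
    where
    open ≲-Reasoning ≲-preorder hiding (start)
    open Hybrid {N} {workspace A} x

    ψ₀ : State N (workspace A)
    ψ₀ = apply (U₀ A) (ket (start A))

    chain : fromℚ (ι (sensitivity f x)) ≲ fromℚ (18ℚ * bound t)
    chain = begin
      fromℚ (ι (sensitivity f x))
        ≈⟨ Σℝ.Additive.∑ᶠ-additive {A = ⊤} (λ g → fromℚ (ι (g tt))) ≃-refl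
             (λ g h → pointwise-≃ λ _ → ι-+ (g tt) (h tt)) (λ i _ → sensitive f x i) ⟩
      Σℝ.∑ᶠ (λ i → fromℚ (ι (sensitive f x i)))
        ≲⟨ ∑ᶠ-mono (sensitive≲dist² x) ⟩
      Σℝ.∑ᶠ (λ i → 18ℚ · dist² (finalState A x) (finalState A (flip x i)))
        ≈⟨ ·-∑ᶠ 18ℚ (λ i → dist² (finalState A x) (finalState A (flip x i))) ⟨
      18ℚ · totalDist² (finalState A x) (λ i → finalState A (flip x i))
        -- Before the first query all runs share `ψ₀`, so the hybrid argument starts at `s = 0`,
        -- where `bound` is zero.
        ≲⟨ ·-mono (ℚ.positive⁻¹ 18ℚ) (totalDist²-run 0 (Us A) ψ₀ (λ _ → ψ₀)
             (≃-trans (norm²-apply (U₀ A) (ket (start A))) (norm²-ket (start A)))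
             (≃⇒≲ (≃-trans (Σℝ.∑ᶠ-zero {N} λ _ → dist²-self ψ₀) (pointwise-≃ λ _ → refl)))) ⟩
      18ℚ · fromℚ (bound t)
        ≈⟨ pointwise-≃ (λ _ → refl) ⟩
      fromℚ (18ℚ * bound t) ∎

    expand : ι (72 ℕ.* (t ℕ.* suc t)) ≡ 18ℚ * bound t
    expand = trans (ι-* 72 (t ℕ.* suc t)) (trans (cong (ι 72 *_) (ι-* t (suc t))) (ℚ.*-assoc 18ℚ 4ℚ (ι t * ι (suc t))))

-- Homomorphisms

-- Homomorphisms into `complete k` are the proper colourings with `k` colours, so colourings are
-- transported by `Hom-trans`.
complete : ∀ k → Graph k
complete k = graph k (λ _ → true)

complete-edge : ∀ {k} {u v : Fin k} → u ≢ v → Edge (complete k) u v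
complete-edge {u = zero}  {zero}  u≢v = ⊥-elim (u≢v refl)
complete-edge {u = zero}  {suc v} u≢v = _
complete-edge {u = suc u} {zero}  u≢v = _
complete-edge {u = suc u} {suc v} u≢v = complete-edge (u≢v ∘ cong suc)

edge⇒≢ : ∀ {n} (G : Graph n) u v → Edge G u v → u ≢ v
edge⇒≢ G u v e refl = subst T (irrefl G u) e

Hom-trans : ∀ {l m n} {F : Graph l} {G : Graph m} {H : Graph n} → Hom F G → Hom G H → Hom F H
Hom-trans (g , g-hom) (h , h-hom) = h ∘ g , λ u v e → h-hom (g u) (g v) (g-hom u v e)

Hom-complete : ∀ {n} (H : Graph n) → Hom H (complete n)
Hom-complete H = (λ u → u) , λ u v e → complete-edge (edge⇒≢ H u v e)

¬Hom-complete₁ : ∀ {n} (H : Graph n) → HasEdge H → ¬ Hom H (complete 1)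
¬Hom-complete₁ H (u , v , e) (h , h-hom) with h u | h v | h-hom u v e
... | zero | zero | ()

-- Decodes the lexicographic numbering of pairs. The last component holds for all `y`, because the
-- recursive call is used at the restriction of `y` to the later positions.
endpoints : ∀ m (e : Fin (pairs m)) → ∃ λ u → ∃ λ v → u ≢ v × (∀ y → bit m y u v ≡ y e)
endpoints (suc n) e with splitAt n e | Fin.join-splitAt n (pairs n) e
... | inj₁ v  | refl = zero , suc v , (λ ()) , λ _ → refl
... | inj₂ e′ | refl with endpoints n e′
... | u , v , u≢v , h = suc u , suc v , u≢v ∘ Fin.suc-injective , λ y → h (y ∘ (n ↑ʳ_))

bit-const : ∀ m b {y} → (∀ e → y e ≡ b) → ∀ {u v} → u ≢ v → bit m y u v ≡ b
bit-const (suc m) b h {zero}  {zero}  u≢v = ⊥-elim (u≢v refl)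
bit-const (suc m) b h {zero}  {suc v} u≢v = h (v ↑ˡ pairs m)
bit-const (suc m) b h {suc u} {zero}  u≢v = h (u ↑ˡ pairs m)
bit-const (suc m) b h {suc u} {suc v} u≢v = bit-const m b (h ∘ (m ↑ʳ_)) (u≢v ∘ cong suc)

Hom-all-edges : ∀ {m y} → (∀ e → y e ≡ true) → Hom (complete m) (graph m y)
Hom-all-edges {m} h = (λ u → u) , λ u v e →
  subst T (sym (bit-const m true h (edge⇒≢ (complete m) u v e))) _

Hom-no-edges : ∀ {m y} → (∀ e → y e ≡ false) → Hom (graph m y) (complete 1)
Hom-no-edges {m} {y} h = (λ _ → zero) , λ u v e →
  ⊥-elim (subst T (bit-const m false h (edge⇒≢ (graph m y) u v e)) e)

Hom-some-edge : ∀ {m y} e → y e ≡ true → Hom (complete 2) (graph m y)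
Hom-some-edge {m} {y} e ye with endpoints m e
... | u , v , _ , h = (λ { zero → u ; (suc zero) → v }) , λ
  { zero       (suc zero) _ → edge
  ; (suc zero) zero       _ → subst T (bit-symm m y u v) edge
  ; (suc zero) (suc zero) () }
  where
  edge : Edge (graph m y) u v
  edge = subst T (sym (trans (h y) ye)) _

-- A graph with a non-adjacent pair is coloured by giving both vertices of
-- the pair the same colour.
Hom-missing-edge : ∀ {m y} e → y e ≡ false → Hom (graph (suc m) y) (complete m)
Hom-missing-edge {m} {y} e ye with endpoints (suc m) e
... | u , v , u≢v , h = (λ w → colour w (v Fin.≟ w)) , λ w w′ edge →
    complete-edge (distinct w w′ (v Fin.≟ w) (v Fin.≟ w′) edge)
  where
  ¬edge : ¬ Edge (graph (suc m) y) u v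
  ¬edge = subst T (trans (h y) ye)

  colour : ∀ w → Dec (v ≡ w) → Fin m
  -- `punchOut` renumbers the vertices other than `v`; here `v` takes the number of `u`.
  colour w (yes _)   = punchOut (u≢v ∘ sym)
  colour w (no v≢w)  = punchOut v≢w

  distinct : ∀ w w′ d d′ → Edge (graph (suc m) y) w w′ → colour w d ≢ colour w′ d′
  distinct w w′ (yes refl) (yes refl) edge _ = edge⇒≢ (graph (suc m) y) w w′ edge refl
  distinct w w′ (yes refl) (no v≢w′) edge eq with Fin.punchOut-injective (u≢v ∘ sym) v≢w′ eq
  ... | refl = ¬edge (subst T (bit-symm (suc m) y v u) edge)
  distinct w w′ (no v≢w) (yes refl) edge eq with Fin.punchOut-injective v≢w (u≢v ∘ sym) eq
  ... | refl = ¬edge edge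
  distinct w w′ (no v≢w) (no v≢w′) edge eq = edge⇒≢ (graph (suc m) y) w w′ edge (Fin.punchOut-injective v≢w v≢w′ eq)

-- Sensitive inputs

-- Padded b j P x: in the graph x on j + m vertices each of the first j vertices is
-- adjacent to all later vertices (b = true) or to none of them (b = false),
-- and the graph induced on the last m vertices satisfies P.
Padded : Bool → ∀ j {m} → (Input (pairs m) → Set) → Input (pairs (j ℕ.+ m)) → Set
Padded b zero        P x = P x
Padded b (suc j) {m} P x =
  (∀ v → x (v ↑ˡ pairs (j ℕ.+ m)) ≡ b) × Padded b j P (λ e → x ((j ℕ.+ m) ↑ʳ e))

module _ {m : ℕ} {P : Input (pairs m) → Set} where

  Hom-into-isolated : ∀ {k} {F : Graph k} → (∀ {y} → P y → Hom F (graph m y)) →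
    ∀ j {x} → Padded false j P x → Hom F (graph (j ℕ.+ m) x)
  Hom-into-isolated base zero    p       = base p
  Hom-into-isolated {F = F} base (suc j) (_ , p) with Hom-into-isolated {F = F} base j p
  ... | h , h-hom = suc ∘ h , h-hom

  -- All isolated vertices get the colour `zero`, whence the form `suc k` of the number of colours.
  Hom-from-isolated : ∀ {k} → (∀ {y} → P y → Hom (graph m y) (complete (suc k))) →
    ∀ j {x} → Padded false j P x → Hom (graph (j ℕ.+ m) x) (complete (suc k))
  Hom-from-isolated base zero    p       = base p
  Hom-from-isolated base (suc j) (q , p) with Hom-from-isolated base j p
  ... | h , h-hom = (λ { zero → zero ; (suc v) → h v }) , λ
    { zero    (suc v) e → ⊥-elim (subst T (q v) e)
    ; (suc u) zero    e → ⊥-elim (subst T (q u) e)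
    ; (suc u) (suc v) e → h-hom u v e }

  -- Each of the `j` cone vertices is given a fresh colour.
  Hom-from-cone : ∀ {k} → (∀ {y} → P y → Hom (graph m y) (complete k)) →
    ∀ j {x} → Padded true j P x → Hom (graph (j ℕ.+ m) x) (complete (j ℕ.+ k))
  Hom-from-cone base zero    p       = base p
  Hom-from-cone base (suc j) (_ , p) with Hom-from-cone base j p
  ... | h , h-hom = (λ { zero → zero ; (suc v) → suc (h v) }) , λ
    { zero    (suc v) e → _
    ; (suc u) zero    e → _
    ; (suc u) (suc v) e → h-hom u v e }

  -- Each cone vertex, adjacent to all later vertices, enlarges the clique found among them by one.
  Hom-into-cone : ∀ {k} → (∀ {y} → P y → Hom (complete k) (graph m y)) →
    ∀ j {x} → Padded true j P x → Hom (complete (j ℕ.+ k)) (graph (j ℕ.+ m) x)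
  Hom-into-cone base zero    p       = base p
  Hom-into-cone base (suc j) (q , p) with Hom-into-cone base j p
  ... | h , h-hom = (λ { zero → zero ; (suc v) → suc (h v) }) , λ
    { zero    (suc v) _ → subst T (sym (q (h v))) _
    ; (suc u) zero    _ → subst T (sym (q (h u))) _
    ; (suc u) (suc v) e → h-hom u v e }

-- `pad false true` is a complete graph with `j` isolated vertices added; `pad true false` is the
-- join of a complete graph on `j` vertices with an edgeless graph.
pad : Bool → Bool → ∀ j m → Input (pairs (j ℕ.+ m))
pad b c zero    m = λ _ → c
pad b c (suc j) m = (λ (_ : Fin (j ℕ.+ m)) → b) ++ pad b c j m

-- Locates a pair of the last `m` vertices within the larger graph, where the pairs containing an
-- earlier vertex are numbered first.
embed : ∀ j {m} → Fin (pairs m) → Fin (pairs (j ℕ.+ m))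
embed zero        e = e
embed (suc j) {m} e = (j ℕ.+ m) ↑ʳ embed j e

pad-padded : ∀ b c j m → Padded b j {m} (λ y → ∀ e → y e ≡ c) (pad b c j m)
pad-padded b c j m = go j (λ _ → refl)
  where
  -- The induction is over inputs that agree pointwise with `pad`, since restricting to later
  -- vertices yields a smaller `pad` only pointwise.
  go : ∀ j {z} → (∀ i → z i ≡ pad b c j m i) → Padded b j {m} (λ y → ∀ e → y e ≡ c) z
  go zero    h = h
  go (suc j) h =
    (λ v → trans (h (v ↑ˡ pairs (j ℕ.+ m))) (lookup-++ˡ (λ (_ : Fin (j ℕ.+ m)) → b) (pad b c j m) v)) ,
    go j (λ e → trans (h ((j ℕ.+ m) ↑ʳ e)) (lookup-++ʳ (λ (_ : Fin (j ℕ.+ m)) → b) (pad b c j m) e))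

↑ˡ≢↑ʳ : ∀ {k l} (i : Fin k) (j : Fin l) → i ↑ˡ l ≢ k ↑ʳ j
↑ˡ≢↑ʳ {suc k} (suc i) j eq = ↑ˡ≢↑ʳ i j (Fin.suc-injective eq)

flip-padded : ∀ {b c} j {m} (e : Fin (pairs m)) {x} → Padded b j {m} (λ y → ∀ e → y e ≡ c) x →
  Padded b j {m} (λ y → y e ≡ not c) (flip x (embed j e))
flip-padded {b} {c} j {m} e {x} p = go j p (updateAt-updates (embed j e) x) (λ i i≢ → updateAt-minimal i (embed j e) x i≢)
  where
  -- `z` stands for the flipped input, known only through its values; this description passes to the
  -- restriction to later vertices.
  go : ∀ j {x z} → Padded b j {m} (λ y → ∀ e → y e ≡ c) x → z (embed j e) ≡ not (x (embed j e)) →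
    (∀ i → i ≢ embed j e → z i ≡ x i) → Padded b j {m} (λ y → y e ≡ not c) z
  go zero    h       at off = trans at (cong not (h e))
  go (suc j) (q , p) at off =
    (λ v → trans (off (v ↑ˡ pairs (j ℕ.+ m)) (↑ˡ≢↑ʳ v (embed j e))) (q v)) ,
    go j p at (λ i i≢ → off ((j ℕ.+ m) ↑ʳ i) (i≢ ∘ Fin.↑ʳ-injective (j ℕ.+ m) i (embed j e)))

sum-suffix : ∀ k {l} (g : Fin (k ℕ.+ l) → ℕ) → foldr ℕ._+_ 0 (g ∘ (k ↑ʳ_)) ℕ.≤ foldr ℕ._+_ 0 g
sum-suffix zero    g = ℕ.≤-refl
sum-suffix (suc k) g = ℕ.≤-trans (sum-suffix k (g ∘ suc)) (ℕ.m≤n+m _ (g zero))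

sum-ones : ∀ {k} (g : Fin k → ℕ) → (∀ i → g i ≡ 1) → k ℕ.≤ foldr ℕ._+_ 0 g
sum-ones {zero}  g h = ℕ.z≤n
sum-ones {suc k} g h = ℕ.+-mono-≤ (ℕ.≤-reflexive (sym (h zero))) (sum-ones (g ∘ suc) (h ∘ suc))

sum-embed : ∀ j {m} (g : Fin (pairs (j ℕ.+ m)) → ℕ) → (∀ e → g (embed j e) ≡ 1) → pairs m ℕ.≤ foldr ℕ._+_ 0 g
sum-embed zero        g h = sum-ones g h
sum-embed (suc j) {m} g h = ℕ.≤-trans (sum-embed j (g ∘ ((j ℕ.+ m) ↑ʳ_)) h) (sum-suffix (j ℕ.+ m) g)

sensitive≡1 : ∀ {N} (f : Input N → Bool) x i → f (flip x i) ≢ f x → sensitive f x i ≡ 1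
sensitive≡1 f x i f≢ = cong (if_then 0 else 1) (dec-false (f (flip x i) Bool.≟ f x) f≢)

-- Deleting an edge of the complete graph saves a colour, so a homomorphism from `H` into the
-- flipped input would give a colouring that `¬colouring` excludes. The equation for `n` lets the
-- caller keep `H` at its own type.
sensitivity-isolated : ∀ {j k n} → n ≡ j ℕ.+ suc (suc k) → (H : Graph n) →
  Hom H (complete (suc (suc k))) → ¬ Hom H (complete (suc k)) →
  ∃ λ x → pairs (suc (suc k)) ℕ.≤ sensitivity f[ H ] x
sensitivity-isolated {j} {k} refl H colouring ¬colouring = x , sum-embed j (sensitive f[ H ] x) λ e →
  sensitive≡1 f[ H ] x (embed j e) λ eq →
    contradiction (trans (sym (at-flip e)) (trans eq at-x)) λ ()
  where
  x : Input (pairs (j ℕ.+ suc (suc k)))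
  x = pad false true j (suc (suc k))

  at-x : f[ H ] x ≡ true
  at-x = dec-true (hom? H (graph _ x)) (Hom-trans {F = H} {complete (suc (suc k))} {graph _ x} colouring
    (Hom-into-isolated {F = complete (suc (suc k))} Hom-all-edges j (pad-padded false true j (suc (suc k)))))

  at-flip : ∀ e → f[ H ] (flip x (embed j e)) ≡ false
  at-flip e = dec-false (hom? H (graph _ (flip x (embed j e)))) λ h →
    ¬colouring (Hom-trans {F = H} {graph _ (flip x (embed j e))} {complete (suc k)} h
      (Hom-from-isolated (Hom-missing-edge e) j (flip-padded j e (pad-padded false true j (suc (suc k))))))

-- The join has a colouring with `j + 1` colours, one of them for the whole edgeless part. An edge
-- added there completes a clique of size `j + 2`, into which `H` maps by its colouring.
sensitivity-cone : ∀ {j m n} → n ≡ j ℕ.+ m → (H : Graph n) →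
  Hom H (complete (j ℕ.+ 2)) → ¬ Hom H (complete (j ℕ.+ 1)) →
  ∃ λ x → pairs m ℕ.≤ sensitivity f[ H ] x
sensitivity-cone {j} {m} refl H colouring ¬colouring = x , sum-embed j (sensitive f[ H ] x) λ e →
  sensitive≡1 f[ H ] x (embed j e) λ eq →
    contradiction (trans (sym at-x) (trans (sym eq) (at-flip e))) λ ()
  where
  x : Input (pairs (j ℕ.+ m))
  x = pad true false j m

  at-x : f[ H ] x ≡ false
  at-x = dec-false (hom? H (graph _ x)) λ h →
    ¬colouring (Hom-trans {F = H} {graph _ x} {complete (j ℕ.+ 1)} h
      (Hom-from-cone Hom-no-edges j (pad-padded true false j m)))

  at-flip : ∀ e → f[ H ] (flip x (embed j e)) ≡ true
  at-flip e = dec-true (hom? H (graph _ (flip x (embed j e))))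
    (Hom-trans {F = H} {complete (j ℕ.+ 2)} {graph _ (flip x (embed j e))} colouring
      (Hom-into-cone (Hom-some-edge e) j (flip-padded j e (pad-padded true false j m))))

-- For P k = “H is k-colourable”, 2 + j is the chromatic number of H.
threshold : ∀ {P : ℕ → Set} → Decidable P → ¬ P 1 → ∀ n → P (suc n) →
  ∃ λ j → ∃ λ r → suc n ≡ suc (suc (j ℕ.+ r)) × P (suc (suc j)) × ¬ P (suc j)
threshold P? ¬P1 zero    p = contradiction p ¬P1
threshold P? ¬P1 (suc n) p with P? (suc n)
... | no ¬q = n , 0 , cong (λ m → suc (suc m)) (sym (ℕ.+-identityʳ n)) , p , ¬q
... | yes q with threshold P? ¬P1 n q
... | j , r , eq , pj , ¬pj = j , suc r , cong suc (trans eq (cong suc (sym (ℕ.+-suc j r)))) , pj , ¬pj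

-- From edge counts to the number of queries

square≤2pairs : ∀ p → p ℕ.* p ℕ.≤ 2 ℕ.* pairs (suc p)
square≤2pairs zero    = ℕ.z≤n
square≤2pairs (suc p) = begin
  suc p ℕ.* suc p                            ≡⟨ solve 1 (λ p → (con 1 :+ p) :* (con 1 :+ p) := con 2 :* p :+ con 1 :+ p :* p) refl p ⟩
  2 ℕ.* p ℕ.+ 1 ℕ.+ p ℕ.* p                  ≤⟨ ℕ.+-mono-≤ (ℕ.+-monoʳ-≤ (2 ℕ.* p) (ℕ.n≤1+n 1)) (square≤2pairs p) ⟩
  2 ℕ.* p ℕ.+ 2 ℕ.+ 2 ℕ.* pairs (suc p)      ≡⟨ solve 2 (λ p q → con 2 :* p :+ con 2 :+ con 2 :* q := con 2 :* (con 1 :+ p :+ q)) refl p (pairs (suc p)) ⟩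
  2 ℕ.* pairs (suc (suc p))                  ∎
  where
  open ℕ.≤-Reasoning
  open ℕ-Solver

-- The hypothesis gives p² ≤ 144 t (t + 1), which is at most 288 t² < (17 t)² for t ≥ 1; at t = 0
-- both bounds vanish.
pairs-bound : ∀ p t → pairs (suc p) ℕ.≤ 72 ℕ.* (t ℕ.* suc t) → p ℕ.≤ 17 ℕ.* t
pairs-bound p t le = ℕ.≮⇒≥ λ 17t<p → ℕ.<-irrefl refl (begin-strict
  p ℕ.* p                          ≤⟨ square≤2pairs p ⟩
  2 ℕ.* pairs (suc p)              ≤⟨ ℕ.*-monoʳ-≤ 2 le ⟩
  2 ℕ.* (72 ℕ.* (t ℕ.* suc t))     ≤⟨ t*suct≤ t ⟩
  (17 ℕ.* t) ℕ.* (17 ℕ.* t)        <⟨ ℕ.*-mono-< 17t<p 17t<p ⟩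
  p ℕ.* p                          ∎)
  where
  open ℕ.≤-Reasoning
  open ℕ-Solver
  t*suct≤ : ∀ t → 2 ℕ.* (72 ℕ.* (t ℕ.* suc t)) ℕ.≤ (17 ℕ.* t) ℕ.* (17 ℕ.* t)
  t*suct≤ zero        = ℕ.z≤n
  t*suct≤ t@(suc s) = begin
    2 ℕ.* (72 ℕ.* (t ℕ.* suc t))                        ≤⟨ ℕ.m≤m+n _ _ ⟩
    -- The summand added is 289 (s + 1)² - 144 (s + 1) (s + 2).
    2 ℕ.* (72 ℕ.* (t ℕ.* suc t)) ℕ.+ (145 ℕ.* s ℕ.* s ℕ.+ 146 ℕ.* s ℕ.+ 1)
      ≡⟨ solve 1 (λ s → con 2 :* (con 72 :* ((con 1 :+ s) :* (con 2 :+ s))) :+ (con 145 :* s :* s :+ con 146 :* s :+ con 1)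
           := (con 17 :* (con 1 :+ s)) :* (con 17 :* (con 1 :+ s))) refl s ⟩
    (17 ℕ.* t) ℕ.* (17 ℕ.* t) ∎

-- On j + r + 2 vertices with chromatic number j + 2, the complete graph has j + 2 vertices and the
-- edgeless part of the join has r + 2. Each size less one is at most 17 t, and these two numbers
-- add up to the vertex count; adding them replaces a case distinction on which is larger.
queries-bound : ∀ {n} (H : Graph n) → HasEdge H → ∀ t (A : Algorithm (pairs n) t) →
  ComputesBoundedError A f[ H ] → n ℕ.≤ 34 ℕ.* t
queries-bound {zero}  H (() , _) t A computes
queries-bound {suc n} H edge t A computes =
  from-threshold (threshold (λ k → hom? H (complete k)) (¬Hom-complete₁ H edge) n (Hom-complete H))
  where
  few-pairs : ∀ p → (∃ λ x → pairs (suc p) ℕ.≤ sensitivity f[ H ] x) → p ℕ.≤ 17 ℕ.* t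
  few-pairs p (x , le) = pairs-bound p t (ℕ.≤-trans le (sensitivity-bound A f[ H ] computes x))

  from-threshold :
    (∃ λ j → ∃ λ r → suc n ≡ suc (suc (j ℕ.+ r)) × Hom H (complete (suc (suc j))) × ¬ Hom H (complete (suc j))) →
    suc n ℕ.≤ 34 ℕ.* t
  from-threshold (j , r , eq , colouring , ¬colouring) = begin
    suc n                    ≡⟨ eq ⟩
    suc (suc (j ℕ.+ r))      ≡⟨ cong suc (ℕ.+-suc j r) ⟨
    suc j ℕ.+ suc r          ≤⟨ ℕ.+-mono-≤
      (few-pairs (suc j) (sensitivity-isolated {r} (trans eq (ℕ.+-comm (suc (suc j)) r)) H colouring ¬colouring))
      (few-pairs (suc r) (sensitivity-cone {j}
        (trans eq (sym (trans (ℕ.+-suc j (suc r)) (cong suc (ℕ.+-suc j r))))) H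
        (subst (λ k → Hom H (complete k)) (ℕ.+-comm 2 j) colouring)
        (λ h → ¬colouring (subst (λ k → Hom H (complete k)) (ℕ.+-comm j 1) h)))) ⟩
    17 ℕ.* t ℕ.+ 17 ℕ.* t    ≡⟨ ℕ.*-distribʳ-+ t 17 17 ⟨
    34 ℕ.* t                 ∎
    where open ℕ.≤-Reasoning

theorem5 : ∃ λ (c : ℝ) → (0ℝ <ℝ c) × (∀ (n : ℕ) → 2 ℕ.≤ n → (H : Graph n) → HasEdge H → Q[ f[ H ] ]≥ (c *ℝ fromℕ n))
theorem5 = fromℚ 1/34 , (1/34 , ℚ.positive⁻¹ 1/34 , 0 , λ _ _ → ℚ.≤-reflexive (ℚ.+-identityˡ 1/34)) , bound
  where
  -- The inverse of the constant 34 in `queries-bound`.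
  1/34 : ℚ
  1/34 = ℤ.+ 1 / 34

  cancel : ∀ q → 1/34 * (ι 34 * q) ≡ q
  cancel q = trans (sym (ℚ.*-assoc 1/34 (ι 34) q)) (ℚ.*-identityˡ q)

  bound : ∀ n → 2 ℕ.≤ n → (H : Graph n) → HasEdge H → Q[ f[ H ] ]≥ (fromℚ 1/34 *ℝ fromℕ n)
  -- Both sides are constant sequences, so the inequality is proved termwise.
  bound n _ H edge t A computes = unwrap≲ (pointwise-≲ {fromℚ 1/34 *ℝ fromℕ n} {fromℕ t} λ _ → begin
    1/34 * ι n             ≤⟨ ℚ.*-monoˡ-≤-nonNeg 1/34 (ι-mono-≤ (queries-bound H edge t A computes)) ⟩
    1/34 * ι (34 ℕ.* t)    ≡⟨ cong (1/34 *_) (ι-* 34 t) ⟩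
    1/34 * (ι 34 * ι t)    ≡⟨ cancel (ι t) ⟩
    ι t                    ∎)
    where open ℚ.≤-Reasoning
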